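{- Let $C$ be the species of cyclic orders, made into an $\mathfrak S_2$-species by letting the non-identity element $\tau$ of $\mathfrak S_2$ reverse the direction of each cyclic order, and let $e$ be the identity of $\mathfrak S_2$. Then its $\mathfrak S_2$-cycle index series is $$Z^{\mathfrak S_2}_{C}(e)=\sum_{k=1}^{\infty}\frac{\phi(k)}{k}\ln\frac{1}{1-p_k},\qquad Z^{\mathfrak S_2}_{C}(\tau)=\sum_{k=1}^{\infty}\frac12\bigl(p_2^{k}+p_2^{k-1}p_1^{2}\bigr)+\sum_{k=0}^{\infty}p_2^{k}p_1,$$ where $\phi$ is Euler's totient function.
   Context: $C[A]$ is the set of cyclic orders on the finite set $A$ (empty if $A=\emptyset$; a single cyclic order if $|A|=1$ or $|A|=2$); a bijection $\sigma:A\to B$ acts by relabeling, and $\tau$ reverses the cyclic direction, which commutes with relabeling. For a group $\Gamma$ acting on a species $F$ in this way (by permutations $\gamma_A$ of $F[A]$ commuting with all transports $F[\sigma]$), the $\Gamma$-cycle index series is $Z^{\Gamma}_{F}(\gamma)=\sum_{n\ge0}\frac{1}{n!}\sum_{\sigma\in\mathfrak S_n}\mathrm{fix}\bigl(\gamma_{[n]}\circ F[\sigma]\bigr)\,p_1^{\sigma_1}p_2^{\sigma_2}\cdots$, where $[n]=\{1,\dots,n\}$, $\sigma_i$ is the number of $i$-cycles of $\sigma\in\mathfrak S_n$, $p_i$ are the power-sum symmetric functions, and $\mathrm{fix}$ counts fixed points in $F[[n]]$. -}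

module Defs where

open import Data.Bool using (Bool; true; false; _∧_; _∨_; not; if_then_else_)
open import Data.Nat as ℕ using (ℕ; zero; suc; _+_; _*_; _!; _≡ᵇ_)
open import Data.Nat.Properties using (_!≢0)
open import Data.Nat.GCD using (gcd)
open import Data.Fin as Fin using (Fin; toℕ)
open import Data.Fin.Properties using () renaming (_≟_ to _≟ᶠ_)
open import Data.Vec as Vec using (Vec; []; _∷_; lookup; tabulate)
open import Data.List as List using (List; []; _∷_; map; concatMap; filter; length; allFin; upTo; foldr)
open import Data.Bool.ListAction using (and; or)
open import Data.Nat.ListAction using (sum)
open import Data.Integer using (+_)
open import Data.Rational as ℚ using (ℚ; 0ℚ; 1ℚ)
open import Relation.Nullary.Decidable using (⌊_⌋)
open import Relation.Unary using (Decidable)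
open import Relation.Binary.PropositionalEquality using (_≡_)

Fn : ℕ → Set
Fn n = Vec (Fin n) n

app : ∀ {n} → Fn n → Fin n → Fin n
app = lookup

_==ᶠ_ : ∀ {n} → Fin n → Fin n → Bool
i ==ᶠ j = ⌊ i ≟ᶠ j ⌋

allB : ∀ {A : Set} → (A → Bool) → List A → Bool
allB p xs = and (map p xs)

anyB : ∀ {A : Set} → (A → Bool) → List A → Bool
anyB p xs = or (map p xs)

countB : ∀ {A : Set} → (A → Bool) → List A → ℕ
countB p xs = length (List.filter (λ x → Data.Bool._≟_ (p x) true) xs)
  where import Data.Bool

_==ᶠⁿ_ : ∀ {n} → Fn n → Fn n → Bool
_==ᶠⁿ_ {n} f g = allB (λ i → app f i ==ᶠ app g i) (allFin n)

allVecs : ∀ n k → List (Vec (Fin n) k)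
allVecs n zero    = [] ∷ []
allVecs n (suc k) = concatMap (λ i → map (i ∷_) (allVecs n k)) (allFin n)

-- bijectivity (= injectivity for an endofunction of a finite set)
isBij : ∀ {n} → Fn n → Bool
isBij {n} f = allB (λ i → allB (λ j → not (app f i ==ᶠ app f j) ∨ (i ==ᶠ j)) (allFin n)) (allFin n)

perms : ∀ n → List (Fn n)
perms n = filter (λ f → Data.Bool._≟_ (isBij f) true) (allVecs n n)
  where import Data.Bool

_∘ᶠ_ : ∀ {n} → Fn n → Fn n → Fn n
f ∘ᶠ g = tabulate (λ i → app f (app g i))

-- inverse of a permutation (found by search; correct for bijections)
findPre : ∀ {n} → Fn n → Fin n → List (Fin n) → Fin n
findPre f y []       = y
findPre f y (x ∷ xs) = if app f x ==ᶠ y then x else findPre f y xs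

inv : ∀ {n} → Fn n → Fn n
inv {n} f = tabulate (λ y → findPre f y (allFin n))

iter : ∀ {n} → Fn n → ℕ → Fin n → Fin n
iter f zero    x = x
iter f (suc k) x = app f (iter f k x)

-- The species C of cyclic orders.  A cyclic order on [n] is encoded,
-- as usual, by its successor map: a cyclic permutation of [n], i.e. a
-- permutation c such that every element lies on the orbit of 0.
-- There are none for n = 0, exactly one for n = 1, 2.

isCyclic : ∀ {n} → Fn n → Bool
isCyclic {zero}  c = false
isCyclic {suc n} c = allB (λ i → anyB (λ k → iter c k Fin.zero ==ᶠ i) (upTo (suc n))) (allFin (suc n))

Cyc : ∀ n → List (Fn n)
Cyc n = filter (λ c → Data.Bool._≟_ (isCyclic c) true) (perms n)
  where import Data.Bool

transport : ∀ {n} → Fn n → Fn n → Fn n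
transport σ c = σ ∘ᶠ (c ∘ᶠ inv σ)

data S2 : Set where
  e τ : S2

act : ∀ {n} → S2 → Fn n → Fn n
act e c = c
act τ c = inv c      -- reversing a cyclic order = inverting its successor map

fixC : ∀ {n} → S2 → Fn n → ℕ
fixC {n} γ σ = countB (λ c → act γ (transport σ c) ==ᶠⁿ c) (Cyc n)

-- Cycle types.  A monomial of degree n is p_1^{m_1} ... p_n^{m_n},
-- represented by  m : Vec ℕ n  with  lookup m i = m_{i+1}.

cycLen : ∀ {n} → Fn n → Fin n → ℕ
cycLen {n} σ x = go (upTo n)
  where
  go : List ℕ → ℕ
  go []       = 0
  go (k ∷ ks) = if iter σ (suc k) x ==ᶠ x then suc k else go ks

numCycles : ∀ {n} → Fn n → ℕ → ℕ
numCycles σ zero    = 0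
numCycles {n} σ (suc l) = countB (λ x → cycLen σ x ≡ᵇ suc l) (allFin n) ℕ./ suc l

hasType : ∀ {n} → Fn n → Vec ℕ n → Bool
hasType {n} σ m = allB (λ i → numCycles σ (suc (toℕ i)) ≡ᵇ lookup m i) (allFin n)

weight : ∀ {n} → Vec ℕ n → ℕ
weight {n} m = sum (map (λ i → suc (toℕ i) * lookup m i) (allFin n))

Zcoeff : S2 → (n : ℕ) → Vec ℕ n → ℚ
Zcoeff γ n m =
  ((+ sum (map (fixC γ) (filter (λ σ → Data.Bool._≟_ (hasType σ m) true) (perms n))))
    ℚ./ (n !)) {{n !≢0}}
  where import Data.Bool

φ : ℕ → ℕ
φ k = countB (λ j → gcd (suc j) k ≡ᵇ 1) (upTo k)

-- exponent of p_l in the monomial m (0 if l = 0 or l > n)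
expo : ∀ {n} → Vec ℕ n → ℕ → ℕ
expo {n} m zero    = 0
expo {n} m (suc l) = go n m l
  where
  go : ∀ k → Vec ℕ k → ℕ → ℕ
  go _ []       _       = 0
  go _ (a ∷ as) zero    = a
  go _ (a ∷ as) (suc l) = go _ as l

-- m equals the monomial with exponent function f (exponent of p_l is f l),
-- where f l = 0 for all l > s; the comparison is over 1 ≤ l ≤ n + s.
sameMono : ∀ {n} → Vec ℕ n → (ℕ → ℕ) → ℕ → Bool
sameMono {n} m f s = allB (λ l → expo m (suc l) ≡ᵇ f (suc l)) (upTo (n + s))

[_] : Bool → ℚ
[ true ]  = 1ℚ
[ false ] = 0ℚ

sumℚ : List ℚ → ℚ
sumℚ = foldr ℚ._+_ 0ℚ

powMono : ℕ → ℕ → (ℕ → ℕ)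
powMono k j l = if l ≡ᵇ k then j else 0

p2p1 : ℕ → ℕ → (ℕ → ℕ)
p2p1 a b l = if l ≡ᵇ 2 then a else (if l ≡ᵇ 1 then b else 0)

-- Coefficient of m (degree n) in  Σ_{k≥1} (φ(k)/k) ln 1/(1-p_k)
--   = Σ_{k≥1} Σ_{j≥1} φ(k)/(k j) · p_k^j .
-- Only terms with k ≤ n, j ≤ n can have degree n.
rhsE : (n : ℕ) → Vec ℕ n → ℚ
rhsE n m = sumℚ (map (λ k' → sumℚ (map (λ j' →
              let k = suc k' ; j = suc j' in
              [ sameMono m (powMono k j) k ] ℚ.* ((+ φ k) ℚ./ (k * j)))
            (upTo n))) (upTo n))

-- Coefficient of m (degree n) in
--   Σ_{k≥1} ½ (p_2^k + p_2^{k-1} p_1^2) + Σ_{k≥0} p_2^k p_1 .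
-- Only terms with k ≤ n can have degree n.
½ : ℚ
½ = + 1 ℚ./ 2

rhsτ : (n : ℕ) → Vec ℕ n → ℚ
rhsτ n m =
  sumℚ (map (λ k' → let k = suc k' in
      ½ ℚ.* ([ sameMono m (p2p1 k 0) 2 ] ℚ.+ [ sameMono m (p2p1 (k ℕ.∸ 1) 2) 2 ]))
    (upTo n))
  ℚ.+ sumℚ (map (λ k → [ sameMono m (p2p1 k 1) 2 ]) (upTo (suc n)))

{-# OPTIONS --safe #-}
-- Double counting.  A cyclic order c on [n] together with a base point x is
-- the same as a permutation π with π(k) = c^k(x).  In these coordinates c is
-- the rotation k ↦ k + 1 of ℤ/n, so a permutation σ fixing c is a rotation,
-- and one reversing c is a reflection k ↦ i - k.  Counting triples (σ , c , x)
-- as pairs (π , i) gives  n · Σ_σ fix = n! · #{ i | the i-th symmetry has type m }.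
-- The rotation by i consists of n / k cycles of length k = n / gcd(i , n), and
-- φ(k) of the rotations have order k; a reflection has one fixed point if n is
-- odd, and zero or two, equally often, if n is even.
module Submission where

open import Defs
open import Data.Bool using (Bool; true; false; _∧_; _∨_; not; if_then_else_)
import Data.Bool
open import Data.Bool.Properties using (⇔→≡)
open import Data.Nat as ℕ using (ℕ; zero; suc; _+_; _*_; _≤_; _<_; z≤n; s≤s; _!; _≡ᵇ_)
open import Data.Nat.DivMod using (_mod_; _%_; _/_)
import Data.Nat.DivMod as DivMod
import Data.Nat.Properties as ℕₚ
open import Data.Nat.ListAction using (sum)
open import Data.Fin as Fin using (Fin; toℕ; fromℕ<; punchIn; punchOut)
import Data.Fin.Properties as Finₚ
open import Data.Vec using (Vec; []; _∷_; lookup; tabulate)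
import Data.Vec.Properties as Vecₚ
open import Data.List as List using (List; []; _∷_; map; concatMap; filter; length; allFin; upTo; applyUpTo)
import Data.List.Properties as Listₚ
open import Data.List.Membership.Propositional using (_∈_; lose; find)
open import Data.List.Membership.Propositional.Properties
open import Data.List.Relation.Unary.Any as Any using (here; there)
open import Data.List.Relation.Unary.Any.Properties using (lookup-index)
import Data.List.Relation.Unary.All as All
open import Data.List.Relation.Unary.AllPairs using ([]; _∷_)
open import Data.List.Relation.Unary.Unique.Propositional using (Unique)
import Data.List.Relation.Unary.Unique.Propositional.Properties as Uniqueₚ
open import Data.Product using (∃; _×_; _,_; proj₁; proj₂)
open import Data.Sum using (_⊎_; inj₁; inj₂)
open import Function using (_∘_; id; _⇔_; mk⇔; Equivalence)
open import Relation.Nullary using (yes; no; contradiction)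
open import Relation.Binary.PropositionalEquality hiding ([_])
open import Data.Nat.Tactic.RingSolver using (solve-∀)
import Data.Integer as ℤ
import Data.Integer.Properties as ℤₚ
open import Data.Rational as ℚ using (ℚ)
import Data.Rational.Properties as ℚₚ
open import Data.Rational.Unnormalised using (mkℚᵘ; *≡*)
import Data.Rational.Unnormalised.Properties as ℚᵘₚ
open import Data.Nat.Divisibility using (_∣_; divides)
import Data.Nat.Divisibility as Div
open import Data.Nat.GCD using (gcd; gcd[m,n]∣m; gcd[m,n]∣n; c*gcd[m,n]≡gcd[cm,cn])
open import Data.Nat.Coprimality using (gcd≡1⇒coprime; coprime-divisor)
import Data.Nat.Coprimality as Coprimality

-- The base point makes the coordinates canonical: a cyclic order alone determines its enumeration π
-- only up to rotation. Since π conjugates σ to one standard symmetry, the cycle type of σ depends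
-- on the index i alone, and this is what lets a prescribed type m pass through the double count.
-- Once n and n! are divided out, both coefficients of the index series are a number of indices over
-- n. On the right-hand sides the hypothesis `weight m ≡ n` does the matching work: a summand whose
-- monomial equals m has degree n. Hence k j = n in every contributing term φ(k)/(k j), and all
-- these terms share the denominator n; for τ, the degree singles out the few exponents of `p_2`
-- that can occur.

true≢false : ∀ {b} → b ≡ true → b ≢ false
true≢false refl ()

-- Boolean tests and the propositions they decide

allB⁻ : ∀ {A : Set} (p : A → Bool) xs → allB p xs ≡ true → ∀ {x} → x ∈ xs → p x ≡ true
allB⁻ p (x ∷ xs) h (here refl) with p x
... | true = refl
allB⁻ p (x ∷ xs) h (there x∈) with p x
... | true = allB⁻ p xs h x∈

allB⁺ : ∀ {A : Set} (p : A → Bool) xs → (∀ {x} → x ∈ xs → p x ≡ true) → allB p xs ≡ true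
allB⁺ p []       h = refl
allB⁺ p (x ∷ xs) h rewrite h (here refl) = allB⁺ p xs (h ∘ there)

anyB⁻ : ∀ {A : Set} (p : A → Bool) xs → anyB p xs ≡ true → ∃ λ x → x ∈ xs × p x ≡ true
anyB⁻ p (x ∷ xs) h with p x in eq
... | true = x , here refl , eq
... | false with anyB⁻ p xs h
...   | y , y∈ , py = y , there y∈ , py

anyB⁺ : ∀ {A : Set} (p : A → Bool) xs {x} → x ∈ xs → p x ≡ true → anyB p xs ≡ true
anyB⁺ p (x ∷ xs) (here refl) px rewrite px = refl
anyB⁺ p (x ∷ xs) (there x∈) px with p x
... | true  = refl
... | false = anyB⁺ p xs x∈ px

==ᶠ⁻ : ∀ {n} {i j : Fin n} → (i ==ᶠ j) ≡ true → i ≡ j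
==ᶠ⁻ {i = i} {j} h with i Finₚ.≟ j
... | yes i≡j = i≡j

==ᶠ⁺ : ∀ {n} {i j : Fin n} → i ≡ j → (i ==ᶠ j) ≡ true
==ᶠ⁺ {i = i} {j} i≡j with i Finₚ.≟ j
... | yes _   = refl
... | no  i≢j = contradiction i≡j i≢j

≡ᵇ⁻ : ∀ m n → (m ≡ᵇ n) ≡ true → m ≡ n
≡ᵇ⁻ zero    zero    _ = refl
≡ᵇ⁻ (suc m) (suc n) h = cong suc (≡ᵇ⁻ m n h)

≡ᵇ⁺ : ∀ {m n} → m ≡ n → (m ≡ᵇ n) ≡ true
≡ᵇ⁺ {zero}  refl = refl
≡ᵇ⁺ {suc m} refl = ≡ᵇ⁺ {m} refl

≢⇒≡ᵇ-false : ∀ {m n} → m ≢ n → (m ≡ᵇ n) ≡ false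
≢⇒≡ᵇ-false {m} {n} m≢n with m ≡ᵇ n in eq
... | true  = contradiction (≡ᵇ⁻ m n eq) m≢n
... | false = refl

==ᶠⁿ⁻ : ∀ {n} {f g : Fn n} → (f ==ᶠⁿ g) ≡ true → ∀ i → app f i ≡ app g i
==ᶠⁿ⁻ {n} h i = ==ᶠ⁻ (allB⁻ _ (allFin n) h (∈-allFin i))

==ᶠⁿ⁺ : ∀ {n} {f g : Fn n} → (∀ i → app f i ≡ app g i) → (f ==ᶠⁿ g) ≡ true
==ᶠⁿ⁺ {n} h = allB⁺ _ (allFin n) (λ {i} _ → ==ᶠ⁺ (h i))

filterB⁺ : ∀ {A : Set} (p : A → Bool) {xs x} → x ∈ xs → p x ≡ true →
           x ∈ filter (λ y → Data.Bool._≟_ (p y) true) xs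
filterB⁺ p = ∈-filter⁺ (λ y → Data.Bool._≟_ (p y) true)

filterB⁻ : ∀ {A : Set} (p : A → Bool) xs {x} →
           x ∈ filter (λ y → Data.Bool._≟_ (p y) true) xs → x ∈ xs × p x ≡ true
filterB⁻ p xs = ∈-filter⁻ (λ y → Data.Bool._≟_ (p y) true) {xs = xs}

filterB-unique : ∀ {A : Set} (p : A → Bool) {xs} → Unique xs →
                 Unique (filter (λ y → Data.Bool._≟_ (p y) true) xs)
filterB-unique p = Uniqueₚ.filter⁺ (λ y → Data.Bool._≟_ (p y) true)

-- Counting by matchings

unique-lookup-injective : ∀ {A : Set} {xs : List A} → Unique xs →
  ∀ {i j} → List.lookup xs i ≡ List.lookup xs j → i ≡ j
unique-lookup-injective (x∉ ∷ u) {Fin.zero}  {Fin.zero}  eq = refl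
unique-lookup-injective (x∉ ∷ u) {Fin.zero}  {Fin.suc j} eq = contradiction eq (All.lookup x∉ (∈-lookup j))
unique-lookup-injective (x∉ ∷ u) {Fin.suc i} {Fin.zero}  eq = contradiction (sym eq) (All.lookup x∉ (∈-lookup i))
unique-lookup-injective (x∉ ∷ u) {Fin.suc i} {Fin.suc j} eq = cong Fin.suc (unique-lookup-injective u eq)

-- The position of a chosen partner is an injective map between positions: equal positions hold
-- equal partners, and these come from equal elements.
length-≤ : ∀ {A B : Set} (_~_ : A → B → Set) {xs ys} → Unique xs →
           (∀ {x} → x ∈ xs → ∃ λ y → y ∈ ys × (x ~ y)) →
           (∀ {x x′ y} → x ~ y → x′ ~ y → x ≡ x′) →
           length xs ≤ length ys
length-≤ _~_ {xs} {ys} u total inj = Finₚ.injective⇒≤ {f = f} f-injective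
  where
  f : Fin (length xs) → Fin (length ys)
  f i = Any.index (proj₁ (proj₂ (total (∈-lookup i))))

  f-injective : ∀ {i j} → f i ≡ f j → i ≡ j
  f-injective {i} {j} eq with total (∈-lookup {xs = xs} i) | total (∈-lookup {xs = xs} j)
  ... | y , y∈ , x~y | y′ , y′∈ , x′~y′ =
    unique-lookup-injective u (inj x~y (subst (_ ~_) (sym y≡y′) x′~y′))
    where
    y≡y′ : y ≡ y′
    y≡y′ = trans (lookup-index y∈) (trans (cong (List.lookup ys) eq) (sym (lookup-index y′∈)))

-- A bijection given by its graph. A partner of x can often be built only from a proof of `x ∈ xs`,
-- so a pair of functions would have to carry membership proofs along.
record Matching {A B : Set} (xs : List A) (ys : List B) : Set₁ where
  field
    _~_       : A → B → Set
    totalˡ    : ∀ {x} → x ∈ xs → ∃ λ y → y ∈ ys × (x ~ y)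
    totalʳ    : ∀ {y} → y ∈ ys → ∃ λ x → x ∈ xs × (x ~ y)
    uniqueˡ   : ∀ {x x′ y} → x ~ y → x′ ~ y → x ≡ x′
    uniqueʳ   : ∀ {x y y′} → x ~ y → x ~ y′ → y ≡ y′

matching-length : ∀ {A B : Set} {xs : List A} {ys : List B} → Unique xs → Unique ys →
                  Matching xs ys → length xs ≡ length ys
matching-length u v M = ℕₚ.≤-antisym
  (length-≤ _~_ u totalˡ uniqueˡ)
  (length-≤ (λ y x → x ~ y) v totalʳ uniqueʳ)
  where open Matching M

concatMap-unique : ∀ {A B : Set} (f : A → List B) {xs} → Unique xs → (∀ x → Unique (f x)) →
                   (∀ {x y z} → z ∈ f x → z ∈ f y → x ≡ y) → Unique (concatMap f xs)
concatMap-unique f []       uf disj = []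
concatMap-unique f {x ∷ xs} (x∉ ∷ u) uf disj =
  Uniqueₚ.++⁺ (uf x) (concatMap-unique f u uf disj)
    λ (z∈fx , z∈) → let a , a∈ , z∈fa = find (∈-concatMap⁻ f z∈) in
      All.lookup x∉ a∈ (disj z∈fx z∈fa)

pairs : {A B : Set} → List A → (A → List B) → List (A × B)
pairs xs f = concatMap (λ x → map (x ,_) (f x)) xs

∈-pairs⁺ : ∀ {A B : Set} {xs : List A} {f : A → List B} {x y} → x ∈ xs → y ∈ f x → (x , y) ∈ pairs xs f
∈-pairs⁺ {f = f} x∈ y∈ = ∈-concatMap⁺ (λ x → map (x ,_) (f x)) (lose x∈ (∈-map⁺ _ y∈))

∈-pairs⁻ : ∀ {A B : Set} {xs : List A} {f : A → List B} {x y} → (x , y) ∈ pairs xs f → x ∈ xs × y ∈ f x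
∈-pairs⁻ {f = f} xy∈ with find (∈-concatMap⁻ (λ x → map (x ,_) (f x)) xy∈)
... | a , a∈ , xy∈map with ∈-map⁻ (a ,_) xy∈map
...   | _ , y∈ , refl = a∈ , y∈

pairs-unique : ∀ {A B : Set} {xs : List A} {f : A → List B} → Unique xs → (∀ x → Unique (f x)) → Unique (pairs xs f)
pairs-unique {f = f} u uf = concatMap-unique (λ x → map (x ,_) (f x)) u
  (λ x → Uniqueₚ.map⁺ (λ { refl → refl }) (uf x))
  (λ {x} {y} p q → same (∈-map⁻ (x ,_) p) (∈-map⁻ (y ,_) q))
  where
  same : ∀ {x y z} → (∃ λ b → b ∈ f x × z ≡ (x , b)) → (∃ λ b → b ∈ f y × z ≡ (y , b)) → x ≡ y
  same (_ , _ , refl) (_ , _ , refl) = refl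

length-pairs : ∀ {A B : Set} (xs : List A) (f : A → List B) →
               length (pairs xs f) ≡ sum (map (λ x → length (f x)) xs)
length-pairs []       f = refl
length-pairs (x ∷ xs) f = trans (Listₚ.length-++ (map (x ,_) (f x)))
  (cong₂ _+_ (Listₚ.length-map (x ,_) (f x)) (length-pairs xs f))

sum-const : ∀ {A : Set} (c : ℕ) (xs : List A) → sum (map (λ _ → c) xs) ≡ length xs * c
sum-const c []       = refl
sum-const c (x ∷ xs) = cong (c +_) (sum-const c xs)

length-pairs-const : ∀ {A B : Set} (xs : List A) (ys : List B) →
                     length (pairs xs (λ _ → ys)) ≡ length xs * length ys
length-pairs-const xs ys = trans (length-pairs xs _) (sum-const (length ys) xs)

-- Permutations

Inj : ∀ {n} → Fn n → Set
Inj f = ∀ {i j} → app f i ≡ app f j → i ≡ j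

isBij⁻ : ∀ {n} {f : Fn n} → isBij f ≡ true → Inj f
isBij⁻ {n} {f} h {i} {j} eq =
  ==ᶠ⁻ (implies (allB⁻ _ (allFin n) (allB⁻ _ (allFin n) h (∈-allFin i)) (∈-allFin j)) (==ᶠ⁺ eq))
  where
  implies : ∀ {a b} → not a ∨ b ≡ true → a ≡ true → b ≡ true
  implies {true} h refl = h

isBij⁺ : ∀ {n} {f : Fn n} → Inj f → isBij f ≡ true
isBij⁺ {n} {f} inj = allB⁺ _ (allFin n) λ {i} _ → allB⁺ _ (allFin n) λ {j} _ → implies (λ h → ==ᶠ⁺ (inj (==ᶠ⁻ h)))
  where
  implies : ∀ {a b} → (a ≡ true → b ≡ true) → not a ∨ b ≡ true
  implies {true}  h = h refl
  implies {false} h = refl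

∈-allVecs : ∀ {n k} (v : Vec (Fin n) k) → v ∈ allVecs n k
∈-allVecs []      = here refl
∈-allVecs {n} {suc k} (i ∷ v) =
  ∈-concatMap⁺ (λ i → map (i ∷_) (allVecs n k)) (lose (∈-allFin i) (∈-map⁺ (i ∷_) (∈-allVecs v)))

allVecs-unique : ∀ n k → Unique (allVecs n k)
allVecs-unique n zero    = All.[] ∷ []
allVecs-unique n (suc k) = concatMap-unique (λ i → map (i ∷_) (allVecs n k)) (Uniqueₚ.allFin⁺ n)
  (λ i → Uniqueₚ.map⁺ (λ { refl → refl }) (allVecs-unique n k))
  (λ {i} {j} p q → same (∈-map⁻ (i ∷_) p) (∈-map⁻ (j ∷_) q))
  where
  same : ∀ {i j : Fin n} {v : Vec (Fin n) (suc k)} →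
         (∃ λ w → w ∈ allVecs n k × v ≡ i ∷ w) → (∃ λ w → w ∈ allVecs n k × v ≡ j ∷ w) → i ≡ j
  same (_ , _ , refl) (_ , _ , refl) = refl

∈-perms⁺ : ∀ {n} {f : Fn n} → Inj f → f ∈ perms n
∈-perms⁺ {f = f} inj = filterB⁺ isBij (∈-allVecs f) (isBij⁺ {f = f} inj)

∈-perms⁻ : ∀ {n} {f : Fn n} → f ∈ perms n → Inj f
∈-perms⁻ {n} {f} f∈ = isBij⁻ {f = f} (proj₂ (filterB⁻ isBij (allVecs n n) f∈))

perms-unique : ∀ n → Unique (perms n)
perms-unique n = filterB-unique isBij (allVecs-unique n n)

lookup-ext : ∀ {A : Set} {n} {v w : Vec A n} → (∀ i → lookup v i ≡ lookup w i) → v ≡ w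
lookup-ext {v = v} {w} h =
  trans (sym (Vecₚ.tabulate∘lookup v)) (trans (Vecₚ.tabulate-cong h) (Vecₚ.tabulate∘lookup w))

app-tabulate : ∀ {n} (f : Fin n → Fin n) i → app (tabulate f) i ≡ f i
app-tabulate = Vecₚ.lookup∘tabulate

-- A permutation of [n+1] is the value a at 0 together with a permutation
-- of [n] describing the remaining values, which avoid a.
perms-matching : ∀ n → Matching (perms (suc n)) (pairs (allFin (suc n)) (λ _ → perms n))
perms-matching n = record
  { _~_     = λ f (a , g) → app f Fin.zero ≡ a × (∀ k → app f (Fin.suc k) ≡ punchIn a (app g k))
  ; totalˡ  = λ {f} f∈ → let inj = ∈-perms⁻ {f = f} f∈ in
      let 0≢ : ∀ k → app f Fin.zero ≢ app f (Fin.suc k)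
          0≢ k eq = Finₚ.0≢1+n (inj eq)
          g = tabulate (λ k → punchOut (0≢ k))
      in (app f Fin.zero , g)
       , ∈-pairs⁺ (∈-allFin _) (∈-perms⁺ {f = g} λ {i} {j} eq → Finₚ.suc-injective (inj
           (Finₚ.punchOut-injective (0≢ i) (0≢ j)
             (trans (sym (app-tabulate _ i)) (trans eq (app-tabulate _ j))))))
       , refl , λ k → sym (trans (cong (punchIn _) (app-tabulate _ k)) (Finₚ.punchIn-punchOut (0≢ k)))
  ; totalʳ  = λ { {a , g} ag∈ → let g-inj = ∈-perms⁻ {f = g} (proj₂ (∈-pairs⁻ {xs = allFin (suc n)} ag∈)) in
      (a ∷ tabulate (λ k → punchIn a (app g k)))
    , ∈-perms⁺ (cons-injective a g g-inj)
    , refl , Vecₚ.lookup∘tabulate (λ k → punchIn a (app g k)) }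
  ; uniqueˡ = λ { (p , q) (p′ , q′) → lookup-ext λ { Fin.zero    → trans p (sym p′)
                                                   ; (Fin.suc k) → trans (q k) (sym (q′ k)) } }
  ; uniqueʳ = λ { {f} {a , g} {a′ , g′} (refl , q) (refl , q′) →
      cong (a ,_) (lookup-ext λ k → Finₚ.punchIn-injective a _ _ (trans (sym (q k)) (q′ k))) }
  }
  where
  cons-injective : ∀ a (g : Fn n) → Inj g → Inj (a ∷ tabulate (λ k → punchIn a (app g k)))
  cons-injective a g inj {Fin.zero}  {Fin.zero}  eq = refl
  cons-injective a g inj {Fin.zero}  {Fin.suc j} eq =
    contradiction (sym (trans eq (Vecₚ.lookup∘tabulate _ j))) (Finₚ.punchInᵢ≢i a _)
  cons-injective a g inj {Fin.suc i} {Fin.zero}  eq =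
    contradiction (trans (sym (Vecₚ.lookup∘tabulate _ i)) eq) (Finₚ.punchInᵢ≢i a _)
  cons-injective a g inj {Fin.suc i} {Fin.suc j} eq =
    cong Fin.suc (inj (Finₚ.punchIn-injective a _ _
      (trans (sym (Vecₚ.lookup∘tabulate _ i)) (trans eq (Vecₚ.lookup∘tabulate _ j)))))

length-perms : ∀ n → length (perms n) ≡ n !
length-perms zero    = refl
length-perms (suc n) = trans
  (matching-length (perms-unique (suc n)) (pairs-unique (Uniqueₚ.allFin⁺ _) (λ _ → perms-unique n)) (perms-matching n))
  (trans (length-pairs-const (allFin (suc n)) (perms n))
    (cong₂ _*_ (Listₚ.length-tabulate {n = suc n} id) (length-perms n)))

-- Pigeonhole: if y were missed, punching y out of the codomain would inject `Fin (suc n)` into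
-- `Fin n`.
injective⇒surjective : ∀ {n} (f : Fin n → Fin n) → (∀ {i j} → f i ≡ f j → i ≡ j) → ∀ y → ∃ λ x → f x ≡ y
injective⇒surjective {suc n} f inj y with Finₚ.any? (λ x → f x Finₚ.≟ y)
... | yes p = p
... | no ¬p = contradiction
  (Finₚ.injective⇒≤ {f = λ x → punchOut {i = y} {j = f x} (λ eq → ¬p (x , sym eq))}
    (λ eq → inj (Finₚ.punchOut-injective {i = y} _ _ eq)))
  ℕₚ.1+n≰n

-- A choice g of preimages is injective because f undoes it, hence surjective; so i and j are values
-- of g, and f recovers the arguments.
surjective⇒injective : ∀ {n} (f : Fin n → Fin n) → (∀ y → ∃ λ x → f x ≡ y) → ∀ {i j} → f i ≡ f j → i ≡ j
surjective⇒injective f surj {i} {j} eq with g-surj i | g-surj j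
  where
  g : _ → _
  g y = proj₁ (surj y)
  g-surj : ∀ x → ∃ λ y → g y ≡ x
  g-surj = injective⇒surjective g λ {a} {b} e →
    trans (sym (proj₂ (surj a))) (trans (cong f e) (proj₂ (surj b)))
... | a , refl | b , refl =
  cong (λ y → proj₁ (surj y)) (trans (sym (proj₂ (surj a))) (trans eq (proj₂ (surj b))))

-- The witness x only guarantees that the search succeeds before it falls back to the default y.
findPre-correct : ∀ {n} (f : Fn n) y xs {x} → x ∈ xs → app f x ≡ y → app f (findPre f y xs) ≡ y
findPre-correct f y (x ∷ xs) x∈ fx≡y with app f x ==ᶠ y in eq
findPre-correct f y (x ∷ xs) x∈          fx≡y | true  = ==ᶠ⁻ eq
findPre-correct f y (x ∷ xs) (here refl) fx≡y | false = contradiction eq (true≢false (==ᶠ⁺ fx≡y))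
findPre-correct f y (x ∷ xs) (there x∈)  fx≡y | false = findPre-correct f y xs x∈ fx≡y

Inj⇒surj : ∀ {n} {f : Fn n} → Inj f → ∀ y → ∃ λ x → app f x ≡ y
Inj⇒surj {f = f} = injective⇒surjective (app f)

app-inv : ∀ {n} {f : Fn n} → Inj f → ∀ y → app f (app (inv f) y) ≡ y
app-inv {n} {f} inj y with Inj⇒surj {f = f} inj y
... | x , fx≡y = trans (cong (app f) (app-tabulate _ y)) (findPre-correct f y (allFin n) (∈-allFin x) fx≡y)

inv-app : ∀ {n} {f : Fn n} → Inj f → ∀ x → app (inv f) (app f x) ≡ x
inv-app {f = f} inj x = inj (app-inv {f = f} inj (app f x))

-- Evaluating the conjugate at points `app σ x` turns it into an intertwining equation without
-- inverses, the form in which conjugacy is used below.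
app-transport : ∀ {n} (σ c : Fn n) → Inj σ → ∀ x → app (transport σ c) (app σ x) ≡ app σ (app c x)
app-transport σ c inj x = trans (app-tabulate _ (app σ x)) (cong (app σ)
  (trans (app-tabulate _ (app σ x)) (cong (app c) (inv-app {f = σ} inj x))))

allB-cong : ∀ {A : Set} {p q : A → Bool} → (∀ x → p x ≡ q x) → ∀ xs → allB p xs ≡ allB q xs
allB-cong h []       = refl
allB-cong h (x ∷ xs) = cong₂ _∧_ (h x) (allB-cong h xs)

countB-cong : ∀ {A : Set} {p q : A → Bool} → (∀ x → p x ≡ q x) → ∀ xs → countB p xs ≡ countB q xs
countB-cong h []       = refl
countB-cong {p = p} {q} h (x ∷ xs) rewrite h x with q x
... | true  = cong suc (countB-cong h xs)
... | false = countB-cong h xs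

countB-perm : ∀ {n} (π : Fn n) → Inj π → (p : Fin n → Bool) →
              countB p (allFin n) ≡ countB (λ k → p (app π k)) (allFin n)
countB-perm {n} π inj p = matching-length
  (filterB-unique p (Uniqueₚ.allFin⁺ n)) (filterB-unique _ (Uniqueₚ.allFin⁺ n)) record
  { _~_     = λ x k → app π k ≡ x
  ; totalˡ  = λ {x} x∈ → let k , πk≡x = Inj⇒surj {f = π} inj x in
      k , filterB⁺ _ (∈-allFin k) (trans (cong p πk≡x) (proj₂ (filterB⁻ p (allFin n) x∈))) , πk≡x
  ; totalʳ  = λ {k} k∈ → app π k , filterB⁺ p (∈-allFin _) (proj₂ (filterB⁻ _ (allFin n) k∈)) , refl
  ; uniqueˡ = λ { refl refl → refl }
  ; uniqueʳ = λ { refl eq → inj (sym eq) }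
  }

-- Cycle lengths and cycle types under conjugation

first : (ℕ → Bool) → List ℕ → ℕ
first p []       = 0
first p (k ∷ ks) = if p k then suc k else first p ks

first-cong : ∀ {p q} → (∀ k → p k ≡ q k) → ∀ ks → first p ks ≡ first q ks
first-cong h []       = refl
first-cong h (k ∷ ks) rewrite h k | first-cong h ks = refl

first-applyUpTo : ∀ p f n k → k < n → p (f k) ≡ true → (∀ j → j < k → p (f j) ≡ false) →
                  first p (applyUpTo f n) ≡ suc (f k)
first-applyUpTo p f (suc n) zero    k<n       hit miss rewrite hit = refl
first-applyUpTo p f (suc n) (suc k) (s≤s k<n) hit miss rewrite miss 0 (s≤s z≤n) =
  first-applyUpTo p (f ∘ suc) n k k<n hit (λ j j<k → miss (suc j) (s≤s j<k))

-- The search loop inside cycLen cannot be named from outside its module;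
-- unification recovers it once its list argument is a variable.
mutual
  cycLen-loop : ∀ {n} → Fn n → Fin n → List ℕ → ℕ
  cycLen-loop = _

  cycLen-unfold : ∀ {n} (σ : Fn n) x → cycLen σ x ≡ cycLen-loop σ x (upTo n)
  cycLen-unfold {n} σ x with upTo n
  ... | ks = refl

cycLen≡first : ∀ {n} (σ : Fn n) x → cycLen σ x ≡ first (λ k → iter σ (suc k) x ==ᶠ x) (upTo n)
cycLen≡first {n} σ x = trans (cycLen-unfold σ x) (loop≡first (upTo n))
  where
  loop≡first : ∀ ks → cycLen-loop σ x ks ≡ first (λ k → iter σ (suc k) x ==ᶠ x) ks
  loop≡first []       = refl
  loop≡first (k ∷ ks) = cong (if iter σ (suc k) x ==ᶠ x then suc k else_) (loop≡first ks)

cycLen≡ : ∀ {n} (σ : Fn n) x k → k < n → iter σ (suc k) x ≡ x → (∀ j → j < k → iter σ (suc j) x ≢ x) →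
          cycLen σ x ≡ suc k
cycLen≡ {n} σ x k k<n hit miss = trans (cycLen≡first σ x)
  (first-applyUpTo _ id n k k<n (==ᶠ⁺ hit) (λ j j<k → ≢⇒==ᶠ-false (miss j j<k)))
  where
  ≢⇒==ᶠ-false : ∀ {i j : Fin n} → i ≢ j → (i ==ᶠ j) ≡ false
  ≢⇒==ᶠ-false {i} {j} i≢j with i ==ᶠ j in eq
  ... | true  = contradiction (==ᶠ⁻ eq) i≢j
  ... | false = refl

module _ {n} (σ ρ π : Fn n) (π-inj : Inj π) (σπ≡πρ : ∀ k → app σ (app π k) ≡ app π (app ρ k)) where

  conj-injective : Inj ρ → Inj σ
  conj-injective ρ-inj {x} {y} eq with Inj⇒surj {f = π} π-inj x | Inj⇒surj {f = π} π-inj y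
  ... | i , refl | j , refl =
    cong (app π) (ρ-inj (π-inj (trans (sym (σπ≡πρ i)) (trans eq (σπ≡πρ j)))))

  iter-conj : ∀ a k → iter σ a (app π k) ≡ app π (iter ρ a k)
  iter-conj zero    k = refl
  iter-conj (suc a) k = trans (cong (app σ) (iter-conj a k)) (σπ≡πρ _)

  -- π carries the ρ-orbit of k step by step to the σ-orbit of its image, so both searches meet the
  -- same sequence of test results.
  cycLen-conj : ∀ k → cycLen σ (app π k) ≡ cycLen ρ k
  cycLen-conj k = trans (cycLen≡first σ (app π k)) (trans (first-cong same (upTo n)) (sym (cycLen≡first ρ k)))
    where
    same : ∀ a → (iter σ (suc a) (app π k) ==ᶠ app π k) ≡ (iter ρ (suc a) k ==ᶠ k)
    same a = ⇔→≡ (mk⇔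
      (λ h → ==ᶠ⁺ (π-inj (trans (sym (iter-conj (suc a) k)) (==ᶠ⁻ h))))
      (λ h → ==ᶠ⁺ (trans (iter-conj (suc a) k) (cong (app π) (==ᶠ⁻ h)))))

  numCycles-conj : ∀ l → numCycles σ l ≡ numCycles ρ l
  numCycles-conj zero    = refl
  numCycles-conj (suc l) = cong (_/ suc l)
    (trans (countB-perm π π-inj _) (countB-cong (λ k → cong (_≡ᵇ suc l) (cycLen-conj k)) (allFin n)))

  hasType-conj : ∀ m → hasType σ m ≡ hasType ρ m
  hasType-conj m = allB-cong (λ i → cong (_≡ᵇ lookup m i) (numCycles-conj (suc (toℕ i)))) (allFin n)

iter-+ : ∀ {n} (f : Fn n) a b x → iter f (a + b) x ≡ iter f a (iter f b x)
iter-+ f zero    b x = refl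
iter-+ f (suc a) b x = cong (app f) (iter-+ f a b x)

iter-app : ∀ {n} (f : Fn n) a x → iter f a (app f x) ≡ app f (iter f a x)
iter-app f zero    x = refl
iter-app f (suc a) x = cong (app f) (iter-app f a x)

iter-injective : ∀ {n} (f : Fn n) → Inj f → ∀ a {x y} → iter f a x ≡ iter f a y → x ≡ y
iter-injective f inj zero    eq = eq
iter-injective f inj (suc a) eq = iter-injective f inj a (inj eq)

iter-* : ∀ {n} (f : Fn n) p {x} → iter f p x ≡ x → ∀ a → iter f (a * p) x ≡ x
iter-* f p fix zero    = refl
iter-* f p fix (suc a) = trans (iter-+ f p (a * p) _) (trans (cong (iter f p) (iter-* f p fix a)) fix)

-- The dihedral group

module Mod (n₀ : ℕ) where

  n : ℕ
  n = suc n₀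

  infix 4 _≈_
  -- Congruence mod n, wrapped in a record so that a and b can be inferred from the type of a proof;
  -- a bare equation of remainders would not determine them.
  record _≈_ (a b : ℕ) : Set where
    constructor mk≈
    field un≈ : a % n ≡ b % n
  open _≈_ public

  ≈-refl : ∀ {a} → a ≈ a
  ≈-refl = mk≈ refl

  ≈-reflexive : ∀ {a b} → a ≡ b → a ≈ b
  ≈-reflexive refl = ≈-refl

  ≈-sym : ∀ {a b} → a ≈ b → b ≈ a
  ≈-sym (mk≈ p) = mk≈ (sym p)

  ≈-trans : ∀ {a b c} → a ≈ b → b ≈ c → a ≈ c
  ≈-trans (mk≈ p) (mk≈ q) = mk≈ (trans p q)

  +-cong-≈ : ∀ {a b c d} → a ≈ b → c ≈ d → a + c ≈ b + d
  +-cong-≈ {a} {b} {c} {d} (mk≈ p) (mk≈ q) = mk≈ (trans (DivMod.%-distribˡ-+ a c n)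
    (trans (cong₂ (λ x y → (x + y) % n) p q) (sym (DivMod.%-distribˡ-+ b d n))))

  %-≈ : ∀ a → a % n ≈ a
  %-≈ a = mk≈ (DivMod.m%n%n≡m%n a n)

  +-multiple : ∀ a k → a + k * n ≈ a
  +-multiple a k = mk≈ (DivMod.[m+kn]%n≡m%n a k n)

  -- n₀ = n - 1 represents -1, so k * n₀ is the negative of k.
  +-neg : ∀ a k → a + (k + k * n₀) ≈ a
  +-neg a k = ≈-trans (≈-reflexive (cong (a +_) (sym (ℕₚ.*-suc k n₀)))) (+-multiple a k)

  +-cancelʳ-≈ : ∀ s {a b} → a + s ≈ b + s → a ≈ b
  +-cancelʳ-≈ s {a} {b} p = ≈-trans (≈-sym (+-neg a s)) (≈-trans
    (≈-trans (≈-reflexive (sym (ℕₚ.+-assoc a s _))) (≈-trans (+-cong-≈ p ≈-refl) (≈-reflexive (ℕₚ.+-assoc b s _))))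
    (+-neg b s))

  ≈⇒≡ : ∀ {a b} → a < n → b < n → a ≈ b → a ≡ b
  ≈⇒≡ a<n b<n (mk≈ p) = trans (sym (DivMod.m<n⇒m%n≡m a<n)) (trans p (DivMod.m<n⇒m%n≡m b<n))

  toℕ-mod : ∀ a → toℕ (a mod n) ≈ a
  toℕ-mod a = ≈-trans (≈-reflexive (Finₚ.toℕ-fromℕ< _)) (%-≈ a)

  toℕ-≈-injective : ∀ {i j : Fin n} → toℕ i ≈ toℕ j → i ≡ j
  toℕ-≈-injective {i} {j} p = Finₚ.toℕ-injective (≈⇒≡ (Finₚ.toℕ<n i) (Finₚ.toℕ<n j) p)

  rot : Fn n
  rot = tabulate λ k → suc (toℕ k) mod n

  -- The permutations commuting with rot are the rotations k ↦ k + (i + 1),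
  -- those inverting it the reflections k ↦ i - k.
  symm : S2 → ℕ → ℕ → ℕ
  symm e i k = k + suc i
  symm τ i k = i + k * n₀

  -- For `e` the shifts run from 1 to n, not from 0 to n - 1, in agreement with the range over which
  -- `φ` counts; the identity is the rotation with the largest index.
  R : S2 → Fin n → Fn n
  R γ i = tabulate λ k → symm γ (toℕ i) (toℕ k) mod n

  app-rot : ∀ k → toℕ (app rot k) ≈ suc (toℕ k)
  app-rot k = ≈-trans (≈-reflexive (cong toℕ (app-tabulate (λ l → suc (toℕ l) mod n) k))) (toℕ-mod (suc (toℕ k)))

  app-R : ∀ γ i k → toℕ (app (R γ i) k) ≈ symm γ (toℕ i) (toℕ k)
  app-R γ i k = ≈-trans (≈-reflexive (cong toℕ (app-tabulate (λ l → symm γ (toℕ i) (toℕ l) mod n) k)))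
    (toℕ-mod (symm γ (toℕ i) (toℕ k)))

  -- This replaces subtraction: up to congruence, `symm τ i k` is the only residue whose sum with k
  -- is i, so statements about reflections are proved by adding k and cancelling it.
  reflect-+ : ∀ i k → symm τ i k + k ≈ i
  reflect-+ i k = ≈-trans (≈-reflexive (trans (ℕₚ.+-assoc i _ k) (cong (i +_) (ℕₚ.+-comm _ k)))) (+-neg i k)

  symm-cong : ∀ γ i {k l} → k ≈ l → symm γ i k ≈ symm γ i l
  symm-cong e i p = +-cong-≈ p ≈-refl
  symm-cong τ i {k} {l} p = +-cancelʳ-≈ l (≈-trans (+-cong-≈ ≈-refl (≈-sym p))
    (≈-trans (reflect-+ i k) (≈-sym (reflect-+ i l))))

  symm-injective : ∀ γ i {k l} → symm γ i k ≈ symm γ i l → k ≈ l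
  symm-injective e i p = +-cancelʳ-≈ (suc i) p
  symm-injective τ i {k} {l} p = +-cancelʳ-≈ (symm τ i k)
    (≈-trans (≈-reflexive (ℕₚ.+-comm k _)) (≈-trans (reflect-+ i k) (≈-trans (≈-sym (reflect-+ i l))
      (≈-trans (+-cong-≈ (≈-sym p) ≈-refl) (≈-reflexive (ℕₚ.+-comm _ l))))))

  symm-0-injective : ∀ γ {i j} → symm γ i 0 ≈ symm γ j 0 → i ≈ j
  symm-0-injective e {i} {j} p = +-cancelʳ-≈ 1
    (≈-trans (≈-reflexive (ℕₚ.+-comm i 1)) (≈-trans p (≈-reflexive (ℕₚ.+-comm 1 j))))
  symm-0-injective τ {i} {j} p = +-cancelʳ-≈ 0 p

  rot-injective : Inj rot
  rot-injective {k} {l} eq = toℕ-≈-injective (+-cancelʳ-≈ 1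
    (≈-trans (≈-reflexive (ℕₚ.+-comm _ 1)) (≈-trans (≈-sym (app-rot k))
      (≈-trans (≈-reflexive (cong toℕ eq)) (≈-trans (app-rot l) (≈-reflexive (ℕₚ.+-comm 1 _)))))))

  R-injective : ∀ γ i → Inj (R γ i)
  R-injective γ i {k} {l} eq = toℕ-≈-injective (symm-injective γ (toℕ i)
    (≈-trans (≈-sym (app-R γ i k)) (≈-trans (≈-reflexive (cong toℕ eq)) (app-R γ i l))))

  R-index-injective : ∀ γ {i j} → app (R γ i) Fin.zero ≡ app (R γ j) Fin.zero → i ≡ j
  R-index-injective γ {i} {j} eq = toℕ-≈-injective (symm-0-injective γ
    (≈-trans (≈-sym (app-R γ i Fin.zero)) (≈-trans (≈-reflexive (cong toℕ eq)) (app-R γ j Fin.zero))))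

  iter-rot : ∀ a k → toℕ (iter rot a k) ≈ a + toℕ k
  iter-rot zero    k = ≈-refl
  iter-rot (suc a) k = ≈-trans (app-rot _) (+-cong-≈ {1} ≈-refl (iter-rot a k))

  iter-mod : ∀ (f : Fn n) {x} → iter f n x ≡ x → ∀ {a b} → a ≈ b → iter f a x ≡ iter f b x
  iter-mod f {x} fix {a} {b} (mk≈ p) = trans (reduce a) (trans (cong (λ r → iter f r x) p) (sym (reduce b)))
    where
    reduce : ∀ a → iter f a x ≡ iter f (a % n) x
    reduce a = trans (cong (λ r → iter f r x) (DivMod.m≡m%n+[m/n]*n a n))
      (trans (iter-+ f (a % n) _ x) (cong (iter f (a % n)) (iter-* f n fix (a / n))))

-- Cyclic orders fixed by a permutation

-- The conditions σ c σ⁻¹ = c and (σ c σ⁻¹)⁻¹ = c with all inverses cleared.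
Rel : ∀ {n} → S2 → Fn n → Fn n → Set
Rel e σ c = ∀ x → app σ (app c x) ≡ app c (app σ x)
Rel τ σ c = ∀ x → app c (app σ (app c x)) ≡ app σ x

module _ {n} (σ c : Fn n) (σ-inj : Inj σ) (c-inj : Inj c) where

  private
    t : Fn n
    t = transport σ c

    t-σ : ∀ x → app t (app σ x) ≡ app σ (app c x)
    t-σ = app-transport σ c σ-inj

    t-inj : Inj t
    t-inj = conj-injective t c σ σ-inj t-σ c-inj

  fix⇒Rel : ∀ γ → (act γ t ==ᶠⁿ c) ≡ true → Rel γ σ c
  fix⇒Rel e h x = trans (sym (t-σ x)) (==ᶠⁿ⁻ {f = t} {g = c} h (app σ x))
  fix⇒Rel τ h x = trans (cong (app c) (sym (t-σ x)))
    (trans (sym (==ᶠⁿ⁻ {f = inv t} {g = c} h _)) (inv-app {f = t} t-inj (app σ x)))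

  Rel⇒fix : ∀ γ → Rel γ σ c → (act γ t ==ᶠⁿ c) ≡ true
  Rel⇒fix e r = ==ᶠⁿ⁺ {f = t} {g = c} pointwise
    where
    pointwise : ∀ y → app t y ≡ app c y
    pointwise y with Inj⇒surj {f = σ} σ-inj y
    ... | x , refl = trans (t-σ x) (r x)
  Rel⇒fix τ r = ==ᶠⁿ⁺ {f = inv t} {g = c} pointwise
    where
    c-t : ∀ z → app c (app t z) ≡ z
    c-t z with Inj⇒surj {f = σ} σ-inj z
    ... | x , refl = trans (cong (app c) (t-σ x)) (r x)

    pointwise : ∀ y → app (inv t) y ≡ app c y
    pointwise y with Inj⇒surj {f = t} t-inj y
    ... | z , refl = trans (inv-app {f = t} t-inj z) (sym (c-t z))

-- Pointed cyclic orders and their coordinates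

module Count (n₀ : ℕ) where

  open Mod n₀ public

  ∈-Cyc⁺ : ∀ {c} → Inj c → (∀ y → ∃ λ a → a < n × iter c a Fin.zero ≡ y) → c ∈ Cyc n
  ∈-Cyc⁺ {c} inj reach = filterB⁺ isCyclic (∈-perms⁺ {f = c} inj)
    (allB⁺ (λ y → anyB (λ a → iter c a Fin.zero ==ᶠ y) (upTo n)) (allFin n) λ {y} _ →
      let a , a<n , eq = reach y in
      anyB⁺ (λ a → iter c a Fin.zero ==ᶠ y) (upTo n) (∈-upTo⁺ a<n) (==ᶠ⁺ eq))

  ∈-Cyc⁻ : ∀ {c} → c ∈ Cyc n → Inj c × (∀ y → ∃ λ a → a < n × iter c a Fin.zero ≡ y)
  ∈-Cyc⁻ {c} c∈ with filterB⁻ isCyclic (perms n) c∈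
  ... | c∈perms , cyc = ∈-perms⁻ {f = c} c∈perms , λ y →
    let a , a∈ , eq = anyB⁻ (λ a → iter c a Fin.zero ==ᶠ y) (upTo n)
          (allB⁻ (λ y → anyB (λ a → iter c a Fin.zero ==ᶠ y) (upTo n)) (allFin n) cyc (∈-allFin y))
    in a , ∈-upTo⁻ a∈ , ==ᶠ⁻ eq

  module Cyclic (c : Fn n) (c-inj : Inj c) (reach₀ : ∀ y → ∃ λ a → a < n × iter c a Fin.zero ≡ y) where

    orbit : Fin n → Fin n
    orbit k = iter c (toℕ k) Fin.zero

    orbit-surjective : ∀ y → ∃ λ k → orbit k ≡ y
    orbit-surjective y with reach₀ y
    ... | a , a<n , eq = fromℕ< a<n , trans (cong (λ b → iter c b Fin.zero) (Finₚ.toℕ-fromℕ< a<n)) eq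

    -- The n points `orbit k` exhaust `Fin n`, so they are distinct and the n-th iterate is one of
    -- them. If it were a later one than the start, cancelling one application of c would identify
    -- two distinct orbit points.
    period₀ : iter c n Fin.zero ≡ Fin.zero
    period₀ with orbit-surjective (iter c n Fin.zero)
    ... | Fin.zero  , eq = sym eq
    ... | Fin.suc k , eq = contradiction
      (surjective⇒injective orbit orbit-surjective {Fin.fromℕ n₀} {Fin.inject₁ k}
        (trans (cong (λ b → iter c b Fin.zero) (Finₚ.toℕ-fromℕ n₀))
          (trans (sym (c-inj eq)) (cong (λ b → iter c b Fin.zero) (sym (Finₚ.toℕ-inject₁ k))))))
      Finₚ.fromℕ≢inject₁

    period : ∀ x → iter c n x ≡ x
    period x with reach₀ x
    ... | a , _ , refl = trans (sym (iter-+ c n a _)) (trans (cong (λ b → iter c b Fin.zero) (ℕₚ.+-comm n a))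
      (trans (iter-+ c a n _) (cong (iter c a) period₀)))

    module From (x : Fin n) where

      π : Fn n
      π = tabulate λ k → iter c (toℕ k) x

      app-π : ∀ k → app π k ≡ iter c (toℕ k) x
      app-π = app-tabulate _

      π-≈ : ∀ {k a} → toℕ k ≈ a → app π k ≡ iter c a x
      π-≈ {k} p = trans (app-π k) (iter-mod c (period x) p)

      π-surjective : ∀ y → ∃ λ k → app π k ≡ y
      π-surjective y with reach₀ x | reach₀ y
      -- With x and y at distances a and b from 0, the exponent leading from x to y is b - a,
      -- written as `b + a * n₀`.
      ... | a , _ , eqx | b , _ , eqy = (b + a * n₀) mod n , trans (π-≈ (toℕ-mod (b + a * n₀)))
        (trans (cong (iter c (b + a * n₀)) (sym eqx)) (trans (sym (iter-+ c (b + a * n₀) a _))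
          (trans (iter-mod c period₀ (reflect-+ b a)) eqy)))

      π-inj : Inj π
      π-inj = surjective⇒injective (app π) π-surjective

  -- The relation behind the double count: π sends 0 to the base point and conjugates `rot` to c and
  -- the symmetry `R γ i` to σ. Stated by intertwining equations, it can be entered from either
  -- side.
  record Link (γ : S2) (σcx : (Fn n × Fn n) × Fin n) (πi : Fn n × Fin n) : Set where
    private
      σ = proj₁ (proj₁ σcx)
      c = proj₂ (proj₁ σcx)
      x = proj₂ σcx
      π = proj₁ πi
      i = proj₂ πi
    field
      π-inj : Inj π
      π-0   : app π Fin.zero ≡ x
      c-π   : ∀ k → app c (app π k) ≡ app π (app rot k)
      σ-π   : ∀ k → app σ (app π k) ≡ app π (app (R γ i) k)

  link-type : ∀ {γ σ c x π i} → Link γ ((σ , c) , x) (π , i) → ∀ m → hasType σ m ≡ hasType (R γ i) m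
  link-type {γ} {σ} {c} {x} {π} {i} L = hasType-conj σ (R γ i) π π-inj σ-π
    where open Link L

  -- As π is onto, the intertwining equations prescribe σ and c at every point, and x is the image
  -- of 0.
  link-uniqueˡ : ∀ {γ s s′ p} → Link γ s p → Link γ s′ p → s ≡ s′
  link-uniqueˡ {γ} {(σ , c) , x} {(σ′ , c′) , x′} {π , i} L L′ =
    cong₂ _,_ (cong₂ _,_ (ext σ σ′ (R γ i) L.σ-π L′.σ-π) (ext c c′ rot L.c-π L′.c-π)) (trans (sym L.π-0) L′.π-0)
    where
    module L = Link L
    module L′ = Link L′
    ext : ∀ (f g h : Fn n) → (∀ k → app f (app π k) ≡ app π (app h k)) →
          (∀ k → app g (app π k) ≡ app π (app h k)) → f ≡ g
    ext f g h p q = lookup-ext pointwise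
      where
      pointwise : ∀ y → app f y ≡ app g y
      pointwise y with Inj⇒surj {f = π} L.π-inj y
      ... | k , refl = trans (p k) (sym (q k))

  link-orbit : ∀ {γ σ c x π i} → Link γ ((σ , c) , x) (π , i) → ∀ k → app π k ≡ iter c (toℕ k) x
  link-orbit {c = c} {x} {π} L k = sym (trans (cong (iter c (toℕ k)) (sym π-0))
    (trans (iter-conj c rot π π-inj c-π (toℕ k) Fin.zero)
      (cong (app π) (toℕ-≈-injective (≈-trans (iter-rot (toℕ k) Fin.zero) (≈-reflexive (ℕₚ.+-identityʳ _)))))))
    where open Link L

  -- π is forced to enumerate the c-orbit of x. Then σ x fixes the value of `R γ i` at 0, which
  -- determines i.
  link-uniqueʳ : ∀ {γ s p p′} → Link γ s p → Link γ s p′ → p ≡ p′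
  link-uniqueʳ {γ} {(σ , c) , x} {π , i} {π′ , i′} L L′ = cong₂ _,_ π≡π′ i≡i′
    where
    module L = Link L
    module L′ = Link L′
    π≗π′ : ∀ k → app π k ≡ app π′ k
    π≗π′ k = trans (link-orbit L k) (sym (link-orbit L′ k))

    π≡π′ : π ≡ π′
    π≡π′ = lookup-ext π≗π′

    i≡i′ : i ≡ i′
    i≡i′ = R-index-injective γ (L.π-inj (trans (sym (L.σ-π Fin.zero)) (trans (cong (app σ) (π≗π′ Fin.zero))
      (trans (L′.σ-π Fin.zero) (sym (π≗π′ _))))))

  link-fromˡ : ∀ γ {σ c x} → Inj σ → c ∈ Cyc n → Rel γ σ c → ∃ λ p → Link γ ((σ , c) , x) p
  link-fromˡ γ {σ} {c} {x} σ-inj c∈ r with ∈-Cyc⁻ c∈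
  ... | c-inj , reach₀ = helper γ r
    where
    open Cyclic c c-inj reach₀
    open From x

    c-π : ∀ k → app c (app π k) ≡ app π (app rot k)
    c-π k = trans (cong (app c) (app-π k)) (sym (π-≈ (app-rot k)))

    helper : ∀ γ → Rel γ σ c → ∃ λ p → Link γ ((σ , c) , x) p
    -- Measuring σ x from c x instead of x gives σ x = c^(i+1) x, which is the offset built into
    -- `symm e`.
    helper e comm with From.π-surjective (app c x) (app σ x)
    ... | i , eq = (π , i) , record { π-inj = π-inj ; π-0 = app-π Fin.zero ; c-π = c-π ; σ-π = σ-π }
      where
      σ-iter : ∀ a y → app σ (iter c a y) ≡ iter c a (app σ y)
      σ-iter zero    y = refl
      σ-iter (suc a) y = trans (comm _) (cong (app c) (σ-iter a y))

      σx : app σ x ≡ iter c (suc (toℕ i)) x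
      σx = trans (sym eq) (trans (From.app-π (app c x) i) (iter-app c (toℕ i) x))

      σ-π : ∀ k → app σ (app π k) ≡ app π (app (R e i) k)
      σ-π k = trans (cong (app σ) (app-π k)) (trans (σ-iter (toℕ k) x) (trans (cong (iter c (toℕ k)) σx)
        (trans (sym (iter-+ c (toℕ k) _ x)) (sym (π-≈ (app-R e i k))))))
    helper τ anti with π-surjective (app σ x)
    ... | i , eq = (π , i) , record { π-inj = π-inj ; π-0 = app-π Fin.zero ; c-π = c-π ; σ-π = σ-π }
      where
      σ-iter : ∀ a y → iter c a (app σ (iter c a y)) ≡ app σ y
      σ-iter zero    y = refl
      σ-iter (suc a) y = trans (sym (iter-app c a _)) (trans (cong (iter c a) (anti _)) (σ-iter a y))

      σ-π : ∀ k → app σ (app π k) ≡ app π (app (R τ i) k)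
      -- After applying c^k, the left side is c^k σ c^k x = σ x = c^i x, and the right side is c^k
      -- c^(i-k) x.
      σ-π k = iter-injective c c-inj (toℕ k) (trans (cong (λ y → iter c (toℕ k) (app σ y)) (app-π k))
        (trans (σ-iter (toℕ k) x) (trans (sym eq) (trans (app-π i) (sym
          (trans (cong (iter c (toℕ k)) (π-≈ (app-R τ i k))) (trans (sym (iter-+ c (toℕ k) _ x))
            (iter-mod c (period x) (≈-trans (≈-reflexive (ℕₚ.+-comm (toℕ k) _)) (reflect-+ (toℕ i) (toℕ k)))))))))))

  link-fromʳ : ∀ γ {π} i → Inj π →
               Link γ ((transport π (R γ i) , transport π rot) , app π Fin.zero) (π , i)
  link-fromʳ γ {π} i π-inj = record
    { π-inj = π-inj ; π-0 = refl ; c-π = app-transport π rot π-inj ; σ-π = app-transport π (R γ i) π-inj }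

  R-Rel : ∀ γ i → Rel γ (R γ i) rot
  R-Rel e i k = toℕ-≈-injective (≈-trans (app-R e i _) (≈-trans (+-cong-≈ (app-rot k) ≈-refl)
    (≈-sym (≈-trans (app-rot _) (+-cong-≈ {1} ≈-refl (app-R e i k))))))
  -- The identity (i - (k + 1)) + 1 = i - k, checked after adding k to both sides.
  R-Rel τ i k = toℕ-≈-injective (+-cancelʳ-≈ (toℕ k)
    (≈-trans (+-cong-≈ (≈-trans (app-rot (app (R τ i) (app rot k))) (+-cong-≈ {1} ≈-refl
        (≈-trans (app-R τ i (app rot k)) (symm-cong τ (toℕ i) (app-rot k))))) ≈-refl)
      (≈-trans (≈-trans (≈-reflexive (sym (ℕₚ.+-suc _ (toℕ k)))) (reflect-+ (toℕ i) (suc (toℕ k))))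
        (≈-sym (≈-trans (+-cong-≈ (app-R τ i k) ≈-refl) (reflect-+ (toℕ i) (toℕ k)))))))

  module _ {γ σ c x π i} (L : Link γ ((σ , c) , x) (π , i)) where

    open Link L

    link-σ-injective : Inj σ
    link-σ-injective = conj-injective σ (R γ i) π π-inj σ-π (R-injective γ i)

    link-c-injective : Inj c
    link-c-injective = conj-injective c rot π π-inj c-π rot-injective

    link-Rel : Rel γ σ c
    link-Rel = helper γ σ-π (R-Rel γ i)
      where
      helper : ∀ γ {ρ} → (∀ k → app σ (app π k) ≡ app π (app ρ k)) → Rel γ ρ rot → Rel γ σ c
      helper e σ-π r y with Inj⇒surj {f = π} π-inj y
      ... | k , refl = trans (cong (app σ) (c-π k)) (trans (σ-π _) (trans (cong (app π) (r k))
        (sym (trans (cong (app c) (σ-π k)) (c-π _)))))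
      helper τ σ-π r y with Inj⇒surj {f = π} π-inj y
      ... | k , refl = trans (cong (λ z → app c (app σ z)) (c-π k))
        (trans (cong (app c) (σ-π _)) (trans (c-π _) (trans (cong (app π) (r k)) (sym (σ-π k)))))

    link-cyclic : c ∈ Cyc n
    link-cyclic = ∈-Cyc⁺ {c} link-c-injective reach
      where
      reach : ∀ y → ∃ λ a → a < n × iter c a Fin.zero ≡ y
      reach y with Inj⇒surj {f = π} π-inj Fin.zero | Inj⇒surj {f = π} π-inj y
      -- `isCyclic` measures orbits from 0, which need not be the base point: if 0 and y have
      -- coordinates a and b, the exponent is d = b - a mod n.
      ... | a , eqa | b , refl = toℕ d , Finₚ.toℕ<n d , trans (cong (iter c (toℕ d)) (sym eqa))
        (trans (iter-conj c rot π π-inj c-π (toℕ d) a) (cong (app π) (toℕ-≈-injective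
          (≈-trans (iter-rot (toℕ d) a) (≈-trans (+-cong-≈ {c = toℕ a} (toℕ-mod (symm τ (toℕ b) (toℕ a))) ≈-refl) (reflect-+ (toℕ b) (toℕ a)))))))
        where
        d : Fin n
        d = symm τ (toℕ b) (toℕ a) mod n

  module _ (γ : S2) (m : Vec ℕ n) where

    typed : List (Fn n)
    typed = filter (λ σ → Data.Bool._≟_ (hasType σ m) true) (perms n)

    fixed : Fn n → List (Fn n)
    fixed σ = filter (λ c → Data.Bool._≟_ (act γ (transport σ c) ==ᶠⁿ c) true) (Cyc n)

    indices : List (Fin n)
    indices = filter (λ i → Data.Bool._≟_ (hasType (R γ i) m) true) (allFin n)

    link-matching : Matching (pairs (pairs typed fixed) (λ _ → allFin n)) (pairs (perms n) (λ _ → indices))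
    link-matching = record
      { _~_     = Link γ
      ; totalˡ  = toʳ
      ; totalʳ  = toˡ
      ; uniqueˡ = link-uniqueˡ
      ; uniqueʳ = link-uniqueʳ
      }
      where
      toʳ : ∀ {s} → s ∈ pairs (pairs typed fixed) (λ _ → allFin n) →
            ∃ λ p → p ∈ pairs (perms n) (λ _ → indices) × Link γ s p
      toʳ {(σ , c) , x} s∈
        with σc∈ , _ ← ∈-pairs⁻ {xs = pairs typed fixed} s∈
        with σ∈ , c∈ ← ∈-pairs⁻ {xs = typed} {f = fixed} σc∈
        with σ∈perms , σ-type ← filterB⁻ (λ σ → hasType σ m) (perms n) σ∈
        with c∈Cyc , fix ← filterB⁻ (λ c → act γ (transport σ c) ==ᶠⁿ c) (Cyc n) c∈
        with (π , i) , L ← link-fromˡ γ {σ} {c} {x} (∈-perms⁻ {f = σ} σ∈perms) c∈Cyc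
               (fix⇒Rel σ c (∈-perms⁻ {f = σ} σ∈perms) (proj₁ (∈-Cyc⁻ c∈Cyc)) γ fix)
        = (π , i)
        , ∈-pairs⁺ (∈-perms⁺ {f = π} (Link.π-inj L))
            (filterB⁺ (λ i → hasType (R γ i) m) (∈-allFin i) (trans (sym (link-type L m)) σ-type))
        , L

      toˡ : ∀ {p} → p ∈ pairs (perms n) (λ _ → indices) →
            ∃ λ s → s ∈ pairs (pairs typed fixed) (λ _ → allFin n) × Link γ s p
      toˡ {π , i} p∈
        with π∈ , i∈ ← ∈-pairs⁻ {xs = perms n} p∈
        with _ , i-type ← filterB⁻ (λ i → hasType (R γ i) m) (allFin n) i∈
        with L ← link-fromʳ γ {π} i (∈-perms⁻ {f = π} π∈)
        = _
        , ∈-pairs⁺ (∈-pairs⁺ {f = fixed}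
            (filterB⁺ (λ σ → hasType σ m) (∈-perms⁺ {f = transport π (R γ i)} (link-σ-injective L))
              (trans (link-type L m) i-type))
            (filterB⁺ (λ c → act γ (transport (transport π (R γ i)) c) ==ᶠⁿ c) (link-cyclic L)
              (Rel⇒fix (transport π (R γ i)) (transport π rot) (link-σ-injective L) (link-c-injective L) γ (link-Rel L))))
            (∈-allFin _)
        , L

    fix-total : sum (map (fixC γ) typed) * n ≡ n ! * countB (λ i → hasType (R γ i) m) (allFin n)
    fix-total = trans (cong₂ _*_ (sym (length-pairs typed fixed)) (sym (Listₚ.length-tabulate {n = n} id)))
      (trans (sym (length-pairs-const (pairs typed fixed) (allFin n)))
        (trans (matching-length
            (pairs-unique (pairs-unique (filterB-unique (λ σ → hasType σ m) (perms-unique n))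
              (λ σ → filterB-unique (λ c → act γ (transport σ c) ==ᶠⁿ c)
                (filterB-unique isCyclic (perms-unique n)))) (λ _ → Uniqueₚ.allFin⁺ n))
            (pairs-unique (perms-unique n) (λ _ → filterB-unique (λ i → hasType (R γ i) m) (Uniqueₚ.allFin⁺ n)))
            link-matching)
          (trans (length-pairs-const (perms n) indices) (cong (_* length indices) (length-perms n)))))

-- Sums over initial segments and counts as sums

sum-applyUpTo-0 : ∀ (g : ℕ → ℕ) n → (∀ l → g l ≡ 0) → sum (applyUpTo g n) ≡ 0
sum-applyUpTo-0 g zero    h = refl
sum-applyUpTo-0 g (suc n) h = cong₂ _+_ (h 0) (sum-applyUpTo-0 (g ∘ suc) n (h ∘ suc))

sum-applyUpTo-single : ∀ (g : ℕ → ℕ) n k → k < n → (∀ l → l ≢ k → g l ≡ 0) → sum (applyUpTo g n) ≡ g k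
sum-applyUpTo-single g (suc n) zero    k<n       h =
  trans (cong (g 0 +_) (sum-applyUpTo-0 (g ∘ suc) n (λ l → h (suc l) λ ()))) (ℕₚ.+-identityʳ _)
sum-applyUpTo-single g (suc n) (suc k) (s≤s k<n) h =
  cong₂ _+_ (h 0 λ ()) (sum-applyUpTo-single (g ∘ suc) n k k<n (λ l l≢k → h (suc l) (l≢k ∘ ℕₚ.suc-injective)))

sum-applyUpTo-cong : ∀ (g h : ℕ → ℕ) n → (∀ l → l < n → g l ≡ h l) → sum (applyUpTo g n) ≡ sum (applyUpTo h n)
sum-applyUpTo-cong g h zero    eq = refl
sum-applyUpTo-cong g h (suc n) eq =
  cong₂ _+_ (eq 0 (s≤s z≤n)) (sum-applyUpTo-cong (g ∘ suc) (h ∘ suc) n (λ l l<n → eq (suc l) (s≤s l<n)))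

sum-applyUpTo-extend : ∀ (g : ℕ → ℕ) n s → (∀ l → n ≤ l → g l ≡ 0) →
                       sum (applyUpTo g (n + s)) ≡ sum (applyUpTo g n)
sum-applyUpTo-extend g zero    s h = sum-applyUpTo-0 g s (λ l → h l z≤n)
sum-applyUpTo-extend g (suc n) s h = cong (g 0 +_) (sum-applyUpTo-extend (g ∘ suc) n s (λ l n≤l → h (suc l) (s≤s n≤l)))

sum-upTo : ∀ (g : ℕ → ℕ) n → sum (map g (upTo n)) ≡ sum (applyUpTo g n)
sum-upTo g n = cong sum (Listₚ.map-upTo g n)

sum-allFin : ∀ (g : ℕ → ℕ) n → sum (map (g ∘ toℕ) (allFin n)) ≡ sum (applyUpTo g n)
sum-allFin g n = trans (cong sum (Listₚ.map-tabulate {n = n} id (g ∘ toℕ))) (sum-tabulate g n)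
  where
  sum-tabulate : ∀ (g : ℕ → ℕ) n → sum (List.tabulate {n = n} (g ∘ toℕ)) ≡ sum (applyUpTo g n)
  sum-tabulate g zero    = refl
  sum-tabulate g (suc n) = cong (g 0 +_) (sum-tabulate (g ∘ suc) n)

bit : Bool → ℕ
bit true  = 1
bit false = 0

countB≡sum : ∀ {A : Set} (p : A → Bool) xs → countB p xs ≡ sum (map (bit ∘ p) xs)
countB≡sum p []       = refl
countB≡sum p (x ∷ xs) with p x
... | true  = cong suc (countB≡sum p xs)
... | false = countB≡sum p xs

countB-const : ∀ {A : Set} b (xs : List A) → countB (λ _ → b) xs ≡ length xs * bit b
countB-const b xs = trans (countB≡sum (λ _ → b) xs) (sum-const (bit b) xs)

countB-not : ∀ {A : Set} (p : A → Bool) xs → countB p xs + countB (not ∘ p) xs ≡ length xs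
countB-not p []       = refl
countB-not p (x ∷ xs) with p x
... | true  = cong suc (countB-not p xs)
... | false = trans (ℕₚ.+-suc _ _) (cong suc (countB-not p xs))

length-allFin : ∀ n → length (allFin n) ≡ n
length-allFin n = Listₚ.length-tabulate {n = n} id

-- Monomials

coef : ∀ {n} → Vec ℕ n → ℕ → ℕ
coef []       _       = 0
coef (a ∷ as) zero    = a
coef (a ∷ as) (suc l) = coef as l

-- As for cycLen: here the local function also carries the arguments of
-- expo, which have to be generalised separately.
mutual
  expo-loop : ∀ n (m : Vec ℕ n) (l : ℕ) k → Vec ℕ k → ℕ → ℕ
  expo-loop = _

  expo-unfold : ∀ n a (as : Vec ℕ n) l →
                expo (a ∷ as) (suc (suc l)) ≡ expo-loop (suc n) (a ∷ as) (suc l) n as l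
  expo-unfold n a as l with suc n | a ∷ as | suc l
  ... | _ | _ | _ = refl

expo≡coef : ∀ {n} (m : Vec ℕ n) l → expo m (suc l) ≡ coef m l
expo≡coef []       l       = refl
expo≡coef (a ∷ as) zero    = refl
expo≡coef {suc n} (a ∷ as) (suc l) = trans (expo-unfold n a as l) (loop≡coef as l)
  where
  loop≡coef : ∀ {k} (v : Vec ℕ k) j → expo-loop (suc n) (a ∷ as) (suc l) k v j ≡ coef v j
  loop≡coef []       j       = refl
  loop≡coef (b ∷ v)  zero    = refl
  loop≡coef (b ∷ v)  (suc j) = loop≡coef v j

coef-toℕ : ∀ {n} (m : Vec ℕ n) i → coef m (toℕ i) ≡ lookup m i
coef-toℕ (a ∷ m) Fin.zero    = refl
coef-toℕ (a ∷ m) (Fin.suc i) = coef-toℕ m i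

coef-≥ : ∀ {n} (m : Vec ℕ n) l → n ≤ l → coef m l ≡ 0
coef-≥ []      l       _         = refl
coef-≥ (a ∷ m) (suc l) (s≤s n≤l) = coef-≥ m l n≤l

sameMono⁻ : ∀ {n} (m : Vec ℕ n) f s → sameMono m f s ≡ true → ∀ l → l < n + s → coef m l ≡ f (suc l)
sameMono⁻ {n} m f s h l l< = trans (sym (expo≡coef m l))
  (≡ᵇ⁻ _ _ (allB⁻ (λ l → expo m (suc l) ≡ᵇ f (suc l)) (upTo (n + s)) h (∈-upTo⁺ l<)))

sameMono⁺ : ∀ {n} (m : Vec ℕ n) f s → (∀ l → coef m l ≡ f (suc l)) → sameMono m f s ≡ true
sameMono⁺ {n} m f s h = allB⁺ (λ l → expo m (suc l) ≡ᵇ f (suc l)) (upTo (n + s))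
  (λ {l} _ → ≡ᵇ⁺ (trans (expo≡coef m l) (h l)))

-- The two tests compare exponents over different ranges, n and n + s. Past n the exponents of m are
-- 0, and the last hypothesis makes those of f vanish there too.
hasType≡sameMono : ∀ {n} (σ : Fn n) (m : Vec ℕ n) f s →
                   (∀ l → l < n → numCycles σ (suc l) ≡ f (suc l)) → (∀ l → n ≤ l → f (suc l) ≡ 0) →
                   hasType σ m ≡ sameMono m f s
hasType≡sameMono {n} σ m f s small large = ⇔→≡ (mk⇔
  (λ h → sameMono⁺ m f s (λ l → to h l))
  (λ h → allB⁺ type-at (allFin n) λ {i} _ → ≡ᵇ⁺
    (trans (small (toℕ i) (Finₚ.toℕ<n i)) (trans
      (sym (sameMono⁻ m f s h (toℕ i) (ℕₚ.≤-trans (Finₚ.toℕ<n i) (ℕₚ.m≤m+n n s)))) (coef-toℕ m i)))))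
  where
  type-at : Fin n → Bool
  type-at i = numCycles σ (suc (toℕ i)) ≡ᵇ lookup m i

  to : hasType σ m ≡ true → ∀ l → coef m l ≡ f (suc l)
  to h l with l ℕₚ.<? n
  ... | no  l≮n = trans (coef-≥ m l (ℕₚ.≮⇒≥ l≮n)) (sym (large l (ℕₚ.≮⇒≥ l≮n)))
  ... | yes l<n = trans (trans (cong (coef m) (sym toℕ-i)) (coef-toℕ m i))
    (trans (sym (≡ᵇ⁻ _ _ (allB⁻ type-at (allFin n) h (∈-allFin i))))
      (trans (cong (λ a → numCycles σ (suc a)) toℕ-i) (small l l<n)))
    where
    i = fromℕ< l<n
    toℕ-i = Finₚ.toℕ-fromℕ< l<n

-- The weight may be summed over the longer range n + s, since m has no exponents past n; on that
-- range the match replaces each exponent by f.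
weight-sameMono : ∀ {n} (m : Vec ℕ n) f s → sameMono m f s ≡ true →
                  weight m ≡ sum (applyUpTo (λ l → suc l * f (suc l)) (n + s))
weight-sameMono {n} m f s h = trans
  (cong sum (Listₚ.map-cong (λ i → cong (suc (toℕ i) *_) (sym (coef-toℕ m i))) (allFin n)))
  (trans (sum-allFin (λ l → suc l * coef m l) n)
    (trans (sym (sum-applyUpTo-extend _ n s (λ l n≤l → trans (cong (suc l *_) (coef-≥ m l n≤l)) (ℕₚ.*-zeroʳ (suc l)))))
      (sum-applyUpTo-cong _ _ (n + s) (λ l l< → cong (suc l *_) (sameMono⁻ m f s h l l<)))))

weight-powMono : ∀ {n} (m : Vec ℕ n) k j → sameMono m (powMono (suc k) j) (suc k) ≡ true → weight m ≡ suc k * j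
weight-powMono {n} m k j h = trans (weight-sameMono m (powMono (suc k) j) (suc k) h)
  (trans (sum-applyUpTo-single _ (n + suc k) k (ℕₚ.m≤n+m (suc k) n) off) at)
  where
  off : ∀ l → l ≢ k → suc l * powMono (suc k) j (suc l) ≡ 0
  off l l≢k rewrite ≢⇒≡ᵇ-false l≢k = ℕₚ.*-zeroʳ (suc l)
  at : suc k * powMono (suc k) j (suc k) ≡ suc k * j
  at rewrite ≡ᵇ⁺ {k} refl = refl

weight-p2p1 : ∀ {n} (m : Vec ℕ n) a b → sameMono m (p2p1 a b) 2 ≡ true → weight m ≡ (a + a) + b
weight-p2p1 {n} m a b h = trans (weight-sameMono m (p2p1 a b) 2 h)
  -- Writing the range as 2 + n exposes the terms of `p_1` and `p_2`; all later ones are 0.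
  (trans (cong (λ r → sum (applyUpTo g r)) (ℕₚ.+-comm n 2))
    (trans (cong (λ r → 1 * b + (2 * a + r)) (sum-applyUpTo-0 (g ∘ suc ∘ suc) n (λ l → ℕₚ.*-zeroʳ (suc (suc (suc l))))))
      (rearrange a b)))
  where
  g : ℕ → ℕ
  g l = suc l * p2p1 a b (suc l)
  rearrange : ∀ a b → 1 * b + (2 * a + 0) ≡ (a + a) + b
  rearrange = solve-∀

-- Fractions over a common denominator

/-≡ : ∀ a b c d .{{_ : ℕ.NonZero b}} .{{_ : ℕ.NonZero d}} → a * d ≡ c * b → (ℤ.+ a) ℚ./ b ≡ (ℤ.+ c) ℚ./ d
/-≡ a (suc b) c (suc d) eq = ℚₚ.fromℚᵘ-cong {mkℚᵘ (ℤ.+ a) b} {mkℚᵘ (ℤ.+ c) d}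
  (*≡* (trans (sym (ℤₚ.pos-* a (suc d))) (trans (cong ℤ.+_ eq) (ℤₚ.pos-* c (suc b)))))

-- Proved among unnormalised fractions, where addition is plain cross-multiplication with no
-- reduction to lowest terms.
/-+ : ∀ a b d .{{_ : ℕ.NonZero d}} → ((ℤ.+ a) ℚ./ d) ℚ.+ ((ℤ.+ b) ℚ./ d) ≡ (ℤ.+ (a + b)) ℚ./ d
/-+ a b (suc d) = ℚₚ.toℚᵘ-injective (ℚᵘₚ.≃-trans (ℚₚ.toℚᵘ-homo-+ ((ℤ.+ a) ℚ./ suc d) ((ℤ.+ b) ℚ./ suc d))
  (ℚᵘₚ.≃-trans (ℚᵘₚ.+-cong (ℚₚ.toℚᵘ-fromℚᵘ (mkℚᵘ (ℤ.+ a) d)) (ℚₚ.toℚᵘ-fromℚᵘ (mkℚᵘ (ℤ.+ b) d)))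
    (ℚᵘₚ.≃-trans (*≡* cross) (ℚᵘₚ.≃-sym (ℚₚ.toℚᵘ-fromℚᵘ (mkℚᵘ (ℤ.+ (a + b)) d))))))
  where
  D = suc d
  rearrange : ∀ a b D → (a * D + b * D) * D ≡ (a + b) * (D * D)
  rearrange = solve-∀
  cross : (ℤ.+ a ℤ.* ℤ.+ D ℤ.+ ℤ.+ b ℤ.* ℤ.+ D) ℤ.* ℤ.+ D ≡ ℤ.+ (a + b) ℤ.* ℤ.+ (D * D)
  cross = trans (cong (ℤ._* ℤ.+ D) (trans (cong₂ ℤ._+_ (sym (ℤₚ.pos-* a D)) (sym (ℤₚ.pos-* b D)))
                                       (sym (ℤₚ.pos-+ (a * D) (b * D)))))
    (trans (sym (ℤₚ.pos-* (a * D + b * D) D)) (trans (cong ℤ.+_ (rearrange a b D)) (ℤₚ.pos-* (a + b) (D * D))))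

sumℚ-/ : ∀ {A : Set} (t : A → ℚ) (f : A → ℕ) d .{{_ : ℕ.NonZero d}} →
         (∀ x → t x ≡ (ℤ.+ f x) ℚ./ d) → ∀ xs → sumℚ (map t xs) ≡ (ℤ.+ sum (map f xs)) ℚ./ d
sumℚ-/ t f d h []       = /-≡ 0 1 0 d refl
sumℚ-/ t f d h (x ∷ xs) = trans (cong₂ ℚ._+_ (h x) (sumℚ-/ t f d h xs)) (/-+ (f x) (sum (map f xs)) d)

-- The denominators need to agree only where the indicator is 1; a term that is switched off is 0
-- over any denominator.
indicator-/ : ∀ b a d n .{{_ : ℕ.NonZero d}} .{{_ : ℕ.NonZero n}} → (b ≡ true → d ≡ n) →
              [ b ] ℚ.* ((ℤ.+ a) ℚ./ d) ≡ (ℤ.+ (if b then a else 0)) ℚ./ n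
indicator-/ true  a d n h = trans (ℚₚ.*-identityˡ ((ℤ.+ a) ℚ./ d)) (/-≡ a d a n (cong (a *_) (sym (h refl))))
indicator-/ false a d n h = trans (ℚₚ.*-zeroˡ ((ℤ.+ a) ℚ./ d)) (/-≡ 0 1 0 n refl)

-- Rotations

gcd-cofactors : ∀ j t k → gcd t k ≡ 1 → gcd (j * t) (j * k) ≡ j
gcd-cofactors j t k eq = trans (sym (c*gcd[m,n]≡gcd[cm,cn] j t k)) (trans (cong (j *_) eq) (ℕₚ.*-identityʳ j))

module Rotations (n₀ : ℕ) where

  open Count n₀ public

  -- The rotation by i + 1 = j t consists of j cycles of length k, where n = k j;
  -- the three positive numbers k, j, t are represented by their predecessors.
  record Order (i : Fin n) (k j t : ℕ) : Set where
    field
      shift   : suc (toℕ i) ≡ suc j * suc t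
      order   : n ≡ suc k * suc j
      coprime : gcd (suc t) (suc k) ≡ 1

  -- `suc j` is the gcd of the shift i + 1 and n; dividing both by it leaves the coprime cofactors
  -- `suc t` and `suc k`.
  order-exists : ∀ i → ∃ λ k → ∃ λ j → ∃ λ t → Order i k j t
  order-exists i with gcd (suc (toℕ i)) n in eq | gcd[m,n]∣m (suc (toℕ i)) n | gcd[m,n]∣n (suc (toℕ i)) n
  ... | zero    | divides t eqt | _ = contradiction (trans eqt (ℕₚ.*-zeroʳ t)) λ ()
  ... | suc j   | divides zero () | _
  ... | suc j   | _ | divides zero ()
  ... | suc j   | divides (suc t) eqt | divides (suc k) eqk = k , j , t , record
    { shift   = trans eqt (ℕₚ.*-comm (suc t) (suc j))
    ; order   = eqk
    ; coprime = ℕₚ.*-cancelˡ-≡ _ 1 (suc j) (trans (c*gcd[m,n]≡gcd[cm,cn] (suc j) (suc t) (suc k))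
        (trans (cong₂ gcd (trans (ℕₚ.*-comm (suc j) (suc t)) (sym eqt)) (trans (ℕₚ.*-comm (suc j) (suc k)) (sym eqk)))
          (trans eq (sym (ℕₚ.*-identityʳ (suc j))))))
    }

  order-gcd : ∀ {i k j t} → Order i k j t → gcd (suc (toℕ i)) n ≡ suc j
  order-gcd {i} {k} {j} {t} o = trans (cong₂ gcd shift (trans order (ℕₚ.*-comm (suc k) (suc j))))
    (gcd-cofactors (suc j) (suc t) (suc k) coprime)
    where open Order o

  -- In any such decomposition `suc j` is the gcd of the shift and n, and cancelling it from the two
  -- products leaves k and t.
  order-unique : ∀ {i k j t k′ j′ t′} → Order i k j t → Order i k′ j′ t′ → (k , j , t) ≡ (k′ , j′ , t′)
  order-unique {i} {k} {j} {t} {k′} {j′} {t′} o o′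
    with refl ← ℕₚ.suc-injective (trans (sym (order-gcd o)) (order-gcd o′)) =
    cong₂ (λ a b → a , j , b)
      (ℕₚ.suc-injective (ℕₚ.*-cancelʳ-≡ (suc k) (suc k′) (suc j) (trans (sym (Order.order o)) (Order.order o′))))
      (ℕₚ.suc-injective (ℕₚ.*-cancelˡ-≡ (suc t) (suc t′) (suc j) (trans (sym (Order.shift o)) (Order.shift o′))))

  iter-R : ∀ i a y → toℕ (iter (R e i) a y) ≈ toℕ y + a * suc (toℕ i)
  iter-R i zero    y = ≈-reflexive (sym (ℕₚ.+-identityʳ (toℕ y)))
  iter-R i (suc a) y = ≈-trans (app-R e i (iter (R e i) a y)) (≈-trans (+-cong-≈ (iter-R i a y) ≈-refl)
    (≈-reflexive (rearrange (toℕ y) (a * suc (toℕ i)) (suc (toℕ i)))))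
    where
    rearrange : ∀ x y z → x + y + z ≡ x + (z + y)
    rearrange = solve-∀

  module _ {i : Fin n} {k j t : ℕ} (o : Order i k j t) where

    open Order o

    order-≤ : suc k ≤ n
    order-≤ = subst (suc k ≤_) (sym order) (ℕₚ.m≤m*n (suc k) (suc j))

    order-fix : ∀ y → iter (R e i) (suc k) y ≡ y
    order-fix y = toℕ-≈-injective (≈-trans (iter-R i (suc k) y)
      (≈-trans (≈-reflexive (cong (toℕ y +_) multiple)) (+-multiple (toℕ y) (suc t))))
      where
      rearrange : ∀ K J T → K * (J * T) ≡ T * (K * J)
      rearrange = solve-∀
      multiple : suc k * suc (toℕ i) ≡ suc t * n
      multiple = trans (cong (suc k *_) shift)
        (trans (rearrange (suc k) (suc j) (suc t)) (cong (suc t *_) (sym order)))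

    -- A return after a steps means that n divides a times the shift. Cancelling `suc j` leaves that
    -- `suc k` divides `suc t * a`, and it is coprime to `suc t`. So no return comes before `suc k`
    -- steps.
    fix⇒order∣ : ∀ a y → iter (R e i) a y ≡ y → suc k ∣ a
    fix⇒order∣ a y eq = coprime-divisor {suc k} {suc t} {a} (Coprimality.sym (gcd≡1⇒coprime {suc t} {suc k} coprime))
      (Div.*-cancelʳ-∣ (suc j) (subst₂ _∣_ order (trans (cong (a *_) shift) (rearrange a (suc j) (suc t)))
        (Div.m%n≡0⇒n∣m _ n (un≈ a*i≈0))))
      where
      rearrange : ∀ a J T → a * (J * T) ≡ T * a * J
      rearrange = solve-∀
      a*i≈0 : a * suc (toℕ i) ≈ 0
      a*i≈0 = +-cancelʳ-≈ (toℕ y) (≈-trans (≈-reflexive (ℕₚ.+-comm _ (toℕ y)))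
        (≈-trans (≈-sym (iter-R i a y)) (≈-reflexive (cong toℕ eq))))

    cycLen-R : ∀ y → cycLen (R e i) y ≡ suc k
    cycLen-R y = cycLen≡ (R e i) y k order-≤ (order-fix y)
      (λ a a<k eq → ℕₚ.<⇒≱ (s≤s a<k) (Div.∣⇒≤ (fix⇒order∣ (suc a) y eq)))

    numCycles-R : ∀ l → numCycles (R e i) (suc l) ≡ powMono (suc k) (suc j) (suc l)
    numCycles-R l = trans (cong (_/ suc l)
      (trans (countB-cong (λ y → cong (_≡ᵇ suc l) (cycLen-R y)) (allFin n)) (countB-const (k ≡ᵇ l) (allFin n)))) value
      where
      value : length (allFin n) * bit (k ≡ᵇ l) / suc l ≡ powMono (suc k) (suc j) (suc l)
      value with k ℕₚ.≟ l
      ... | yes refl rewrite ≡ᵇ⁺ {k} refl = trans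
        (cong (_/ suc k) (trans (ℕₚ.*-identityʳ _) (trans (length-allFin n) (trans order (ℕₚ.*-comm (suc k) (suc j))))))
        (DivMod.m*n/n≡m (suc j) (suc k))
      ... | no k≢l rewrite ≢⇒≡ᵇ-false k≢l | ≢⇒≡ᵇ-false (k≢l ∘ sym) | ℕₚ.*-zeroʳ (length (allFin n)) = DivMod.0/n≡0 (suc l)

    hasType-R : ∀ m → hasType (R e i) m ≡ sameMono m (powMono (suc k) (suc j)) (suc k)
    hasType-R m = hasType≡sameMono (R e i) m (powMono (suc k) (suc j)) (suc k) (λ l _ → numCycles-R l) large
      where
      large : ∀ l → n ≤ l → powMono (suc k) (suc j) (suc l) ≡ 0
      large l n≤l rewrite ≢⇒≡ᵇ-false {l} {k} (λ l≡k → ℕₚ.<⇒≢ (ℕₚ.≤-trans order-≤ n≤l) (sym l≡k)) = refl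

  module _ (m : Vec ℕ n) (weight≡ : weight m ≡ n) where

    isPower : ℕ → ℕ → Bool
    isPower k j = sameMono m (powMono (suc k) (suc j)) (suc k)

    -- The possible t for given k and j. The filter is the one inside `φ`, so a nonempty case has
    -- length `φ (suc k)` by computation.
    units : ℕ → ℕ → List ℕ
    units k j = if isPower k j then filter (λ t → Data.Bool._≟_ (gcd (suc t) (suc k) ≡ᵇ 1) true) (upTo (suc k)) else []

    units-unique : ∀ k j → Unique (units k j)
    units-unique k j with isPower k j
    ... | true  = filterB-unique (λ t → gcd (suc t) (suc k) ≡ᵇ 1) (Uniqueₚ.upTo⁺ (suc k))
    ... | false = []

    ∈-units⁺ : ∀ {k j t} → isPower k j ≡ true → t < suc k → gcd (suc t) (suc k) ≡ 1 → t ∈ units k j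
    ∈-units⁺ {k} p t<k cop rewrite p = filterB⁺ (λ t → gcd (suc t) (suc k) ≡ᵇ 1) (∈-upTo⁺ t<k) (≡ᵇ⁺ cop)

    ∈-units⁻ : ∀ {k j t} → t ∈ units k j → isPower k j ≡ true × t < suc k × gcd (suc t) (suc k) ≡ 1
    ∈-units⁻ {k} {j} t∈ with isPower k j
    ... | true with t∈upTo , cop ← filterB⁻ (λ t → gcd (suc t) (suc k) ≡ᵇ 1) (upTo (suc k)) t∈
      = refl , ∈-upTo⁻ t∈upTo , ≡ᵇ⁻ _ _ cop

    triples : List (ℕ × ℕ × ℕ)
    triples = pairs (upTo n) λ k → pairs (upTo n) (units k)

    rotation-matching : Matching (indices e m) triples
    rotation-matching = record
      { _~_     = λ i (k , j , t) → Order i k j t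
      ; totalˡ  = toʳ
      ; totalʳ  = toˡ
      ; uniqueˡ = λ o o′ → Finₚ.toℕ-injective (ℕₚ.suc-injective (trans (Order.shift o) (sym (Order.shift o′))))
      ; uniqueʳ = order-unique
      }
      where
      toʳ : ∀ {i} → i ∈ indices e m → ∃ λ s → s ∈ triples × Order i (proj₁ s) (proj₁ (proj₂ s)) (proj₂ (proj₂ s))
      toʳ {i} i∈ with order-exists i
      ... | k , j , t , o = (k , j , t) , ∈-pairs⁺ (∈-upTo⁺ (order-≤ o)) (∈-pairs⁺ {f = units k} (∈-upTo⁺ j<n)
          (∈-units⁺ {k} {j} (trans (sym (hasType-R o m)) (proj₂ (filterB⁻ (λ i → hasType (R e i) m) (allFin n) i∈)))
            t<k coprime)) , o
        where
        open Order o
        j<n : j < n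
        j<n = subst (suc j ≤_) (sym order) (ℕₚ.m≤n*m (suc j) (suc k))
        t<k : t < suc k
        t<k = ℕₚ.*-cancelˡ-≤ (suc j) (subst₂ _≤_ shift (trans order (ℕₚ.*-comm (suc k) (suc j))) (Finₚ.toℕ<n i))

      toˡ : ∀ {s} → s ∈ triples → ∃ λ i → i ∈ indices e m × Order i (proj₁ s) (proj₁ (proj₂ s)) (proj₂ (proj₂ s))
      toˡ {k , j , t} s∈
        with _ , s∈′ ← ∈-pairs⁻ {xs = upTo n} {f = λ k → pairs (upTo n) (units k)} s∈
        with _ , t∈ ← ∈-pairs⁻ {xs = upTo n} {f = units k} s∈′
        with p , t<k , cop ← ∈-units⁻ {k} {j} t∈
        = i , filterB⁺ (λ i → hasType (R e i) m) (∈-allFin i) (trans (hasType-R o m) p) , o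
        where
        order : n ≡ suc k * suc j
        -- Here the degree enters: m equals `p_k^j` with the shifted exponents, so its weight n is
        -- their product.
        order = trans (sym weight≡) (weight-powMono m k (suc j) p)

        -- The number on the left is the predecessor of the shift `suc j * suc t`, which is at most
        -- n because t < `suc k`.
        bound : t + j * suc t < n
        bound = subst (suc j * suc t ≤_) (trans (ℕₚ.*-comm (suc j) (suc k)) (sym order)) (ℕₚ.*-monoʳ-≤ (suc j) t<k)

        i : Fin n
        i = fromℕ< bound

        o : Order i k j t
        o = record { shift = cong suc (Finₚ.toℕ-fromℕ< bound) ; order = order ; coprime = cop }

    count-rotations : countB (λ i → hasType (R e i) m) (allFin n) ≡
                      sum (map (λ k → sum (map (λ j → length (units k j)) (upTo n))) (upTo n))
    count-rotations = trans (matching-length (filterB-unique (λ i → hasType (R e i) m) (Uniqueₚ.allFin⁺ n))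
        (pairs-unique (Uniqueₚ.upTo⁺ n) (λ k → pairs-unique (Uniqueₚ.upTo⁺ n) (units-unique k))) rotation-matching)
      (trans (length-pairs (upTo n) (λ k → pairs (upTo n) (units k)))
        (cong sum (Listₚ.map-cong (λ k → length-pairs (upTo n) (units k)) (upTo n))))

    length-units : ∀ k j → length (units k j) ≡ (if isPower k j then φ (suc k) else 0)
    length-units k j with isPower k j
    ... | true  = refl
    ... | false = refl

    rhsE-term : ∀ k j → [ isPower k j ] ℚ.* ((ℤ.+ φ (suc k)) ℚ./ (suc k * suc j)) ≡ (ℤ.+ length (units k j)) ℚ./ n
    rhsE-term k j = trans
      (indicator-/ (isPower k j) (φ (suc k)) (suc k * suc j) n
        (λ p → trans (sym (weight-powMono m k (suc j) p)) weight≡))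
      (cong (λ a → (ℤ.+ a) ℚ./ n) (sym (length-units k j)))

    rhsE≡ : rhsE n m ≡ (ℤ.+ countB (λ i → hasType (R e i) m) (allFin n)) ℚ./ n
    rhsE≡ = trans
      (sumℚ-/ _ (λ k → sum (map (λ j → length (units k j)) (upTo n))) n
        (λ k → sumℚ-/ _ (λ j → length (units k j)) n (rhsE-term k) (upTo n)) (upTo n))
      (cong (λ a → (ℤ.+ a) ℚ./ n) (sym count-rotations))

-- Reflections

parity : ∀ n → ∃ λ q → n ≡ q + q ⊎ n ≡ suc (q + q)
parity zero    = 0 , inj₁ refl
parity (suc n) with parity n
... | q , inj₁ eq = q , inj₂ (cong suc eq)
... | q , inj₂ eq = suc q , inj₁ (cong suc (trans eq (sym (ℕₚ.+-suc q q))))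

double≢suc-double : ∀ a b → a + a ≢ suc (b + b)
double≢suc-double (suc a) zero    eq = contradiction (ℕₚ.suc-injective (trans (cong suc (sym (ℕₚ.+-suc a a))) eq)) λ ()
double≢suc-double (suc a) (suc b) eq = double≢suc-double a b
  (ℕₚ.suc-injective (trans (sym (ℕₚ.+-suc a a)) (trans (ℕₚ.suc-injective eq) (cong suc (ℕₚ.+-suc b b)))))

double-injective : ∀ {a b} → a + a ≡ b + b → a ≡ b
double-injective {zero}  {zero}  eq = refl
double-injective {suc a} {suc b} eq = cong suc (double-injective (ℕₚ.suc-injective
  (trans (sym (ℕₚ.+-suc a a)) (trans (ℕₚ.suc-injective eq) (ℕₚ.+-suc b b)))))

double-cancel-< : ∀ {a b} → a + a < b + b → a < b
double-cancel-< {a} {b} lt with a ℕₚ.<? b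
... | yes a<b = a<b
... | no  a≮b = contradiction lt (ℕₚ.≤⇒≯ (ℕₚ.+-mono-≤ (ℕₚ.≮⇒≥ a≮b) (ℕₚ.≮⇒≥ a≮b)))

isEven : ℕ → Bool
isEven zero          = true
isEven (suc zero)    = false
isEven (suc (suc n)) = isEven n

isEven-double : ∀ s → isEven (s + s) ≡ true
isEven-double zero    = refl
isEven-double (suc s) rewrite ℕₚ.+-suc s s = isEven-double s

isEven-suc-double : ∀ s → isEven (suc (s + s)) ≡ false
isEven-suc-double zero    = refl
isEven-suc-double (suc s) rewrite ℕₚ.+-suc s s = isEven-suc-double s

sum-alternating : ∀ α β q → sum (applyUpTo (λ i → if isEven i then α else β) (q + q)) ≡ q * (α + β)
sum-alternating α β zero    = refl
sum-alternating α β (suc q) rewrite ℕₚ.+-suc q q =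
  trans (cong (λ r → α + (β + r)) (sum-alternating α β q)) (sym (ℕₚ.+-assoc α β _))

countB≡length : ∀ {n} (p : Fin n → Bool) ys → Unique ys → (∀ y → p y ≡ true ⇔ y ∈ ys) →
                countB p (allFin n) ≡ length ys
countB≡length {n} p ys u h = matching-length (filterB-unique p (Uniqueₚ.allFin⁺ n)) u record
  { _~_     = _≡_
  ; totalˡ  = λ {y} y∈ → y , Equivalence.to (h y) (proj₂ (filterB⁻ p (allFin n) y∈)) , refl
  ; totalʳ  = λ {y} y∈ → y , filterB⁺ p (∈-allFin y) (Equivalence.from (h y) y∈) , refl
  ; uniqueˡ = λ { refl refl → refl }
  ; uniqueʳ = λ { refl refl → refl }
  }

module Reflections (n₀ : ℕ) where

  open Rotations n₀ public

  isFixed : Fin n → Fin n → Bool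
  isFixed i y = app (R τ i) y ==ᶠ y

  -- Adding y to i - y = y gives 2y = i mod n, so counting fixed points means solving this
  -- congruence.
  isFixed⁻ : ∀ i y → isFixed i y ≡ true → toℕ y + toℕ y ≈ toℕ i
  isFixed⁻ i y h = ≈-trans (+-cong-≈ {c = toℕ y}
      (≈-trans (≈-reflexive (cong toℕ (sym (==ᶠ⁻ {i = app (R τ i) y} h)))) (app-R τ i y)) ≈-refl)
    (reflect-+ (toℕ i) (toℕ y))

  isFixed⁺ : ∀ i y → toℕ y + toℕ y ≈ toℕ i → isFixed i y ≡ true
  isFixed⁺ i y h = ==ᶠ⁺ (toℕ-≈-injective (+-cancelʳ-≈ (toℕ y)
    (≈-trans (+-cong-≈ (app-R τ i y) ≈-refl) (≈-trans (reflect-+ (toℕ i) (toℕ y)) (≈-sym h)))))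

  R-involutive : ∀ i y → app (R τ i) (app (R τ i) y) ≡ y
  R-involutive i y = toℕ-≈-injective (+-cancelʳ-≈ (symm τ (toℕ i) (toℕ y))
    (≈-trans (+-cong-≈ {c = symm τ (toℕ i) (toℕ y)}
        (≈-trans (app-R τ i (app (R τ i) y)) (symm-cong τ (toℕ i) (app-R τ i y))) ≈-refl)
      (≈-trans (reflect-+ (toℕ i) (symm τ (toℕ i) (toℕ y)))
        (≈-trans (≈-sym (reflect-+ (toℕ i) (toℕ y))) (≈-reflexive (ℕₚ.+-comm _ (toℕ y)))))))

  -- Needed because `cycLen` searches only lengths up to n: a 2-cycle is found only if n is at least
  -- 2.
  distinct⇒2≤n : ∀ {x y : Fin n} → x ≢ y → 1 < n
  distinct⇒2≤n x≢y = helper n₀ x≢y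
    where
    helper : ∀ k {x y : Fin (suc k)} → x ≢ y → 1 < suc k
    helper zero    {Fin.zero} {Fin.zero} x≢y = contradiction refl x≢y
    helper (suc k) _ = s≤s (s≤s z≤n)

  cycLen-reflection : ∀ i y → cycLen (R τ i) y ≡ (if isFixed i y then 1 else 2)
  cycLen-reflection i y = by-cases (isFixed i y) refl
    where
    by-cases : ∀ b → isFixed i y ≡ b → cycLen (R τ i) y ≡ (if b then 1 else 2)
    by-cases true  eq = cycLen≡ (R τ i) y 0 (s≤s z≤n) (==ᶠ⁻ eq) (λ _ ())
    by-cases false eq = cycLen≡ (R τ i) y 1 (distinct⇒2≤n {app (R τ i) y} {y} moved) (R-involutive i y)
      λ { zero _ → moved ; (suc _) (s≤s ()) }
      where
      moved : app (R τ i) y ≢ y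
      moved fix = true≢false (==ᶠ⁺ fix) eq

  -- An involution has only fixed points and 2-cycles, so b fixed points leave n - b = 2a moved
  -- points, that is a cycles of length 2.
  hasType-reflection : ∀ i a b → countB (isFixed i) (allFin n) ≡ b → (a + a) + b ≡ n →
                       ∀ m → hasType (R τ i) m ≡ sameMono m (p2p1 a b) 2
  hasType-reflection i a b count total m = hasType≡sameMono (R τ i) m (p2p1 a b) 2 small large
    where
    count-length : ∀ l → countB (λ y → cycLen (R τ i) y ≡ᵇ l) (allFin n) ≡
                         countB (λ y → (if isFixed i y then 1 else 2) ≡ᵇ l) (allFin n)
    count-length l = countB-cong (λ y → cong (_≡ᵇ l) (cycLen-reflection i y)) (allFin n)

    ones : ∀ b → ((if b then 1 else 2) ≡ᵇ 1) ≡ b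
    ones true  = refl
    ones false = refl

    twos : ∀ b → ((if b then 1 else 2) ≡ᵇ 2) ≡ not b
    twos true  = refl
    twos false = refl

    others : ∀ l b → ((if b then 1 else 2) ≡ᵇ (3 + l)) ≡ false
    others l true  = refl
    others l false = refl

    moved : countB (not ∘ isFixed i) (allFin n) ≡ a * 2
    moved = ℕₚ.+-cancelˡ-≡ b _ _ (trans (cong (_+ countB (not ∘ isFixed i) (allFin n)) (sym count))
      (trans (countB-not (isFixed i) (allFin n)) (trans (length-allFin n) (trans (sym total) (rearrange a b)))))
      where
      rearrange : ∀ a b → (a + a) + b ≡ b + a * 2
      rearrange = solve-∀

    small : ∀ l → l < n → numCycles (R τ i) (suc l) ≡ p2p1 a b (suc l)
    small zero          _ = trans (DivMod.n/1≡n _) (trans (count-length 1)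
      (trans (countB-cong (ones ∘ isFixed i) (allFin n)) count))
    small (suc zero)    _ = trans (cong (_/ 2) (trans (count-length 2)
      (trans (countB-cong (twos ∘ isFixed i) (allFin n)) moved))) (DivMod.m*n/n≡m a 2)
    small (suc (suc l)) _ = trans (cong (_/ (3 + l)) (trans (count-length (3 + l))
      (trans (countB-cong (others l ∘ isFixed i) (allFin n))
        (trans (countB-const false (allFin n)) (ℕₚ.*-zeroʳ (length (allFin n))))))) (DivMod.0/n≡0 (3 + l))

    large : ∀ l → n ≤ l → p2p1 a b (suc l) ≡ 0
    -- For n = 1 the exponent of `p_2` already lies beyond the degree; it vanishes because 2a + b =
    -- 1.
    large (suc zero) (s≤s n₀≤0) = a≡0 a (trans total (cong suc (ℕₚ.n≤0⇒n≡0 n₀≤0)))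
      where
      a≡0 : ∀ a → (a + a) + b ≡ 1 → a ≡ 0
      a≡0 zero    _  = refl
      a≡0 (suc a) eq = contradiction (trans (sym (cong (_+ b) (ℕₚ.+-suc a a))) (ℕₚ.suc-injective eq)) λ ()
    large (suc (suc l)) _ = refl

  -- For odd n the element 2 is invertible mod n, with inverse q + 1.
  fixed-odd : ∀ q → n ≡ suc (q + q) → ∀ i → countB (isFixed i) (allFin n) ≡ 1
  fixed-odd q n≡ i = countB≡length (isFixed i) (y₀ ∷ []) (All.[] ∷ []) λ y → mk⇔
    (λ h → here (toℕ-≈-injective (≈-trans (half (toℕ y)) (≈-trans (*-cong-≈ (suc q) (isFixed⁻ i y h)) (≈-sym y₀≈)))))
    (λ { (here refl) → isFixed⁺ i y₀ (≈-trans (+-cong-≈ y₀≈ y₀≈)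
      (≈-trans (≈-reflexive (sym (ℕₚ.*-distribˡ-+ (suc q) (toℕ i) (toℕ i)))) (≈-sym (half (toℕ i))))) })
    where
    y₀ : Fin n
    y₀ = (suc q * toℕ i) mod n

    y₀≈ : toℕ y₀ ≈ suc q * toℕ i
    y₀≈ = toℕ-mod (suc q * toℕ i)

    *-cong-≈ : ∀ k {a b} → a ≈ b → k * a ≈ k * b
    *-cong-≈ zero    p = ≈-refl
    *-cong-≈ (suc k) p = +-cong-≈ p (*-cong-≈ k p)

    half : ∀ a → a ≈ suc q * (a + a)
    half a = ≈-trans (≈-sym (+-multiple a a))
      (≈-reflexive (trans (cong (λ r → a + a * r) n≡) (rearrange a q)))
      where
      rearrange : ∀ a q → a + a * suc (q + q) ≡ suc q * (a + a)
      rearrange = solve-∀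

  module _ (q : ℕ) (n≡ : n ≡ q + q) where

    -- Reduction modulo an even n preserves parity, so an even 2y is never congruent to an odd i.
    fixed-even-odd : ∀ i s → toℕ i ≡ suc (s + s) → countB (isFixed i) (allFin n) ≡ 0
    fixed-even-odd i s i≡ = countB≡length (isFixed i) [] [] λ y → mk⇔
      (λ h → contradiction (odd (toℕ y) (isFixed⁻ i y h)) (double≢suc-double (toℕ y) (s + (toℕ y + toℕ y) / n * q))) (λ ())
      where
      rearrange : ∀ s Q q → suc (s + s) + Q * (q + q) ≡ suc ((s + Q * q) + (s + Q * q))
      rearrange = solve-∀
      odd : ∀ y → y + y ≈ toℕ i → y + y ≡ suc ((s + (y + y) / n * q) + (s + (y + y) / n * q))
      odd y (mk≈ p) = trans (DivMod.m≡m%n+[m/n]*n (y + y) n) (trans (cong₂ _+_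
          (trans p (trans (DivMod.m<n⇒m%n≡m (Finₚ.toℕ<n i)) i≡)) (cong ((y + y) / n *_) n≡))
        (rearrange s ((y + y) / n) q))

    -- The solutions of 2y = i mod 2q are the halves s of i and s + q of i + n.
    fixed-even-even : ∀ i s → toℕ i ≡ s + s → countB (isFixed i) (allFin n) ≡ 2
    fixed-even-even i s i≡ = countB≡length (isFixed i) (y₀ ∷ y₁ ∷ []) ((y₀≢y₁ All.∷ All.[]) ∷ All.[] ∷ []) λ y → mk⇔
      (λ h → solve-fixed y (isFixed⁻ i y h))
      (λ { (here refl)         → isFixed⁺ i y₀ (≈-reflexive (trans (cong₂ _+_ y₀≡ y₀≡) (sym i≡)))
         ; (there (here refl)) → isFixed⁺ i y₁ (≈-trans (≈-reflexive (trans (cong₂ _+_ y₁≡ y₁≡) (shift-q s)))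
             (≈-trans (+-multiple (s + s) 1) (≈-reflexive (sym i≡)))) })
      where
      s<q : s < q
      s<q = double-cancel-< (subst₂ _<_ i≡ n≡ (Finₚ.toℕ<n i))

      q≤n : q ≤ n
      q≤n = subst (q ≤_) (sym n≡) (ℕₚ.m≤m+n q q)

      s+q<n : s + q < n
      s+q<n = subst (s + q <_) (sym n≡) (ℕₚ.+-monoˡ-< q s<q)

      y₀ y₁ : Fin n
      y₀ = fromℕ< (ℕₚ.<-≤-trans s<q q≤n)
      y₁ = fromℕ< s+q<n

      y₀≡ : toℕ y₀ ≡ s
      y₀≡ = Finₚ.toℕ-fromℕ< (ℕₚ.<-≤-trans s<q q≤n)

      y₁≡ : toℕ y₁ ≡ s + q
      y₁≡ = Finₚ.toℕ-fromℕ< s+q<n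

      y₀≢y₁ : y₀ ≢ y₁
      y₀≢y₁ eq = ℕₚ.<⇒≢ (ℕₚ.<-≤-trans s<q (ℕₚ.m≤n+m q s)) (trans (sym y₀≡) (trans (cong toℕ eq) y₁≡))

      shift-q : ∀ z → (z + q) + (z + q) ≡ (z + z) + 1 * n
      shift-q z = trans (rearrange z q) (cong (λ r → (z + z) + 1 * r) (sym n≡))
        where
        rearrange : ∀ z q → (z + q) + (z + q) ≡ (z + z) + 1 * (q + q)
        rearrange = solve-∀

      small-root : ∀ z → z < q → z + z ≈ toℕ i → z ≡ s
      small-root z z<q p = double-injective (trans
        (≈⇒≡ (subst (z + z <_) (sym n≡) (ℕₚ.+-mono-< z<q z<q)) (Finₚ.toℕ<n i) p) i≡)

      solve-fixed : ∀ y → toℕ y + toℕ y ≈ toℕ i → y ∈ y₀ ∷ y₁ ∷ []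
      -- Below q the double of y is less than n, so the congruence is an equation; from q on,
      -- subtracting q from y changes the double by exactly n.
      solve-fixed y p with toℕ y ℕₚ.<? q
      ... | yes y<q = here (Finₚ.toℕ-injective (trans (small-root (toℕ y) y<q p) (sym y₀≡)))
      ... | no  y≮q = there (here (Finₚ.toℕ-injective (trans (sym z+q≡y) (trans (cong (_+ q) z≡s) (sym y₁≡)))))
        where
        z : ℕ
        z = toℕ y ℕ.∸ q

        z+q≡y : z + q ≡ toℕ y
        z+q≡y = ℕₚ.m∸n+n≡m (ℕₚ.≮⇒≥ y≮q)

        z<q : z < q
        z<q = ℕₚ.+-cancelʳ-< q z q (subst₂ _<_ (sym z+q≡y) n≡ (Finₚ.toℕ<n y))

        z≡s : z ≡ s
        z≡s = small-root z z<q (≈-trans (≈-sym (+-multiple (z + z) 1))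
          (≈-trans (≈-reflexive (trans (sym (shift-q z)) (cong₂ _+_ z+q≡y z+q≡y))) p))

  module _ (m : Vec ℕ n) (weight≡ : weight m ≡ n) where

    isP2P1 : ℕ → ℕ → Bool
    isP2P1 a b = sameMono m (p2p1 a b) 2

    isP2P1-degree : ∀ a b → isP2P1 a b ≡ true → n ≡ (a + a) + b
    isP2P1-degree a b h = trans (sym weight≡) (weight-p2p1 m a b h)

    bit-isP2P1 : ∀ a b → n ≢ (a + a) + b → bit (isP2P1 a b) ≡ 0
    bit-isP2P1 a b n≢ with isP2P1 a b in eq
    ... | true  = contradiction (isP2P1-degree a b eq) n≢
    ... | false = refl

    -- Numerators over the common denominator 2, whence the factor 2 in the series that carries no
    -- one half. Index k of `even-term` stands for exponent k + 1 in the theorem.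
    even-term odd-term : ℕ → ℕ
    even-term k = bit (isP2P1 (suc k) 0) + bit (isP2P1 k 2)
    odd-term k = 2 * bit (isP2P1 k 1)

    numerator : ℕ
    numerator = sum (map even-term (upTo n)) + sum (map odd-term (upTo (suc n)))

    rhsτ-numerator : rhsτ n m ≡ (ℤ.+ numerator) ℚ./ 2
    rhsτ-numerator = trans (cong₂ ℚ._+_
        (sumℚ-/ _ even-term 2 (λ k → halves (isP2P1 (suc k) 0) (isP2P1 k 2)) (upTo n))
        (sumℚ-/ _ odd-term 2 (λ k → whole (isP2P1 k 1)) (upTo (suc n))))
      (/-+ (sum (map even-term (upTo n))) (sum (map odd-term (upTo (suc n)))) 2)
      where
      halves : ∀ a b → ½ ℚ.* ([ a ] ℚ.+ [ b ]) ≡ (ℤ.+ (bit a + bit b)) ℚ./ 2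
      halves true  true  = refl
      halves true  false = refl
      halves false true  = refl
      halves false false = refl
      whole : ∀ c → [ c ] ≡ (ℤ.+ (2 * bit c)) ℚ./ 2
      whole true  = refl
      whole false = refl

    count : ℕ
    count = countB (λ i → hasType (R τ i) m) (allFin n)

    count-odd : ∀ q → n ≡ suc (q + q) → count ≡ n * bit (isP2P1 q 1)
    count-odd q n≡ = trans (countB-cong (λ i → hasType-reflection i q 1 (fixed-odd q n≡ i)
        (trans (ℕₚ.+-comm (q + q) 1) (sym n≡)) m) (allFin n))
      (trans (countB-const (isP2P1 q 1) (allFin n)) (cong (_* bit (isP2P1 q 1)) (length-allFin n)))

    -- By degree: `even-term k` concerns monomials of degree 2k + 2, and p_2^k p_1 has degree 2k +
    -- 1, which is n only for k = q.
    numerator-odd : ∀ q → n ≡ suc (q + q) → numerator ≡ 2 * bit (isP2P1 q 1)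
    numerator-odd q n≡ = cong₂ _+_
      (trans (sum-upTo even-term n) (sum-applyUpTo-0 even-term n λ k → cong₂ _+_
        (bit-isP2P1 (suc k) 0 λ eq → double≢suc-double (suc k) q
          (trans (sym (ℕₚ.+-identityʳ (suc k + suc k))) (trans (sym eq) n≡)))
        (bit-isP2P1 k 2 λ eq → double≢suc-double (suc k) q (trans (rearrange k) (trans (sym eq) n≡)))))
      (trans (sum-upTo odd-term (suc n)) (sum-applyUpTo-single odd-term (suc n) q q<
        λ k k≢q → cong (2 *_) (bit-isP2P1 k 1 λ eq → k≢q (double-injective
          (ℕₚ.suc-injective (trans (ℕₚ.+-comm 1 (k + k)) (trans (sym eq) n≡)))))))
      where
      rearrange : ∀ k → suc k + suc k ≡ (k + k) + 2
      rearrange = solve-∀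
      q< : q < suc n
      q< = s≤s (subst (q ≤_) (sym n≡) (ℕₚ.m≤n⇒m≤1+n (ℕₚ.m≤m+n q q)))

    -- Even i give two fixed points and p_2^q p_1^2, odd i give none and p_2^(q+1); each parity
    -- occurs q + 1 times below n.
    count-even : ∀ q → n ≡ suc q + suc q → count ≡ suc q * (bit (isP2P1 q 2) + bit (isP2P1 (suc q) 0))
    count-even q n≡ = trans (countB≡sum _ (allFin n)) (trans (cong sum (Listₚ.map-cong type (allFin n)))
      (trans (sum-allFin (λ i → if isEven i then bit (isP2P1 q 2) else bit (isP2P1 (suc q) 0)) n)
        (trans (cong (λ r → sum (applyUpTo (λ i → if isEven i then bit (isP2P1 q 2) else bit (isP2P1 (suc q) 0)) r)) n≡)
          (sum-alternating (bit (isP2P1 q 2)) (bit (isP2P1 (suc q) 0)) (suc q)))))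
      where
      rearrange : ∀ q → (q + q) + 2 ≡ suc q + suc q
      rearrange = solve-∀

      type : ∀ i → bit (hasType (R τ i) m) ≡ (if isEven (toℕ i) then bit (isP2P1 q 2) else bit (isP2P1 (suc q) 0))
      type i with parity (toℕ i)
      ... | s , inj₁ eq rewrite trans (cong isEven eq) (isEven-double s) =
        cong bit (hasType-reflection i q 2 (fixed-even-even (suc q) n≡ i s eq) (trans (rearrange q) (sym n≡)) m)
      ... | s , inj₂ eq rewrite trans (cong isEven eq) (isEven-suc-double s) =
        cong bit (hasType-reflection i (suc q) 0 (fixed-even-odd (suc q) n≡ i s eq)
          (trans (ℕₚ.+-identityʳ (suc q + suc q)) (sym n≡)) m)

    numerator-even : ∀ q → n ≡ suc q + suc q → numerator ≡ bit (isP2P1 (suc q) 0) + bit (isP2P1 q 2)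
    numerator-even q n≡ = trans (cong₂ _+_
        (trans (sum-upTo even-term n) (sum-applyUpTo-single even-term n q q< λ k k≢q → cong₂ _+_
          (bit-isP2P1 (suc k) 0 λ eq → k≢q (ℕₚ.suc-injective (double-injective
            (trans (sym (ℕₚ.+-identityʳ (suc k + suc k))) (trans (sym eq) n≡)))))
          (bit-isP2P1 k 2 λ eq → k≢q (ℕₚ.suc-injective (double-injective
            (trans (rearrange k) (trans (sym eq) n≡)))))))
        (trans (sum-upTo odd-term (suc n)) (sum-applyUpTo-0 odd-term (suc n) λ k → cong (2 *_)
          (bit-isP2P1 k 1 λ eq → double≢suc-double (suc q) k
            (trans (sym n≡) (trans eq (ℕₚ.+-comm (k + k) 1)))))))
      (ℕₚ.+-identityʳ _)
      where
      rearrange : ∀ k → suc k + suc k ≡ (k + k) + 2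
      rearrange = solve-∀
      q< : q < n
      q< = subst (q <_) (sym n≡) (ℕₚ.m≤m+n (suc q) (suc q))

    -- Cross-multiplication of numerator / 2 = count / n. The one half in even degree is the
    -- proportion of reflections of each of the two types.
    numerator-count : numerator * n ≡ count * 2
    numerator-count with parity n
    ... | q , inj₂ n≡ = trans (cong (_* n) (numerator-odd q n≡))
      (trans (rearrange n (bit (isP2P1 q 1))) (cong (_* 2) (sym (count-odd q n≡))))
      where
      rearrange : ∀ n b → 2 * b * n ≡ n * b * 2
      rearrange = solve-∀
    ... | suc q , inj₁ n≡ = trans (cong₂ _*_ (numerator-even q n≡) n≡)
      (trans (rearrange (suc q) (bit (isP2P1 (suc q) 0)) (bit (isP2P1 q 2))) (cong (_* 2) (sym (count-even q n≡))))
      where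
      rearrange : ∀ q a b → (a + b) * (q + q) ≡ q * (b + a) * 2
      rearrange = solve-∀

    rhsτ≡ : rhsτ n m ≡ (ℤ.+ count) ℚ./ n
    rhsτ≡ = trans rhsτ-numerator (/-≡ numerator 2 count n numerator-count)

-- Comparison of coefficients

Zcoeff≡ : ∀ γ n₀ (m : Vec ℕ (suc n₀)) →
          Zcoeff γ (suc n₀) m ≡ (ℤ.+ countB (λ i → hasType (Mod.R n₀ γ i) m) (allFin (suc n₀))) ℚ./ suc n₀
Zcoeff≡ γ n₀ m = /-≡ (sum (map (fixC γ) (typed γ m))) (n !) (countB (λ i → hasType (R γ i) m) (allFin n)) n {{n ℕₚ.!≢0}}
  (trans (fix-total γ m) (ℕₚ.*-comm (n !) _))
  where open Count n₀

theorem6p2 : (n : ℕ) (m : Vec ℕ n) → weight m ≡ n →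
    (Zcoeff e n m ≡ rhsE n m) × (Zcoeff τ n m ≡ rhsτ n m)
-- In degree 0 everything computes: the empty set has no cyclic order, and both series have constant
-- term 0.
theorem6p2 zero     []  _       = refl , refl
theorem6p2 (suc n₀) m   weight≡ =
    trans (Zcoeff≡ e n₀ m) (sym (Reflections.rhsE≡ n₀ m weight≡))
  , trans (Zcoeff≡ τ n₀ m) (sym (Reflections.rhsτ≡ n₀ m weight≡))
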